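{- Let $R$ be an integral domain of characteristic zero, $n,d\ge1$, $F\in R[x]_d$, and $G=x_0^d+\cdots+x_n^d$. Let $s\ge1$, $h\ge(d-1)(n+1)+1$, $v\in B_{ds}$ and $w\in B_h$. For $k\ge1$ and $H\in R[x]_{kds}$ let $[H]_k$ denote the vector $(H_{kv+w-t})_{t\in B_h}$. Then there is a matrix $Q$, with rows and columns indexed by $B_h$ and entries that are polynomials of degree at most $1$ in $R[k,\ell]$, such that for all integers $k_0\ge1$ and $0\le\ell_0<k_0s$, $$d(k_0s-\ell_0)\,[G^{k_0s-\ell_0-1}F^{\ell_0+1}]_{k_0}=Q(k_0,\ell_0)\,[G^{k_0s-\ell_0}F^{\ell_0}]_{k_0},$$ and consequently, for all $k_0\ge1$, in the fraction field of $R$, $$[F^{k_0s}]_{k_0}=\frac{1}{d^{k_0s}(k_0s)!}\,Q(k_0,k_0s-1)\cdots Q(k_0,1)Q(k_0,0)\,[G^{k_0s}]_{k_0}.$$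
   Context: $R[x]=R[x_0,\dots,x_n]$; $R[x]_k$ is the submodule of homogeneous polynomials of degree $k$; $B_k=\{u\in\mathbf N^{n+1}:u_0+\cdots+u_n=k\}$; for $H\in R[x]$ and $u\in\mathbf Z^{n+1}$, $H_u$ is the coefficient of $x^u=x_0^{u_0}\cdots x_n^{u_n}$ in $H$, with $H_u=0$ if some $u_i<0$. -}

module Defs where

open import Algebra.Bundles using (CommutativeRing; Semiring; RawSemiring)
import Algebra.Definitions.RawSemiring as RawSemiringOps
open import Data.Bool.Base using (if_then_else_)
open import Data.Fin.Base using (Fin)
open import Data.Integer.Base using (ℤ; +_; _⊖_)
import Data.Integer.Properties as ℤ
open import Data.List.Base as List using (List; []; _∷_; _++_)
open import Data.List.Membership.Propositional using (_∈_)
open import Data.List.Membership.Propositional.Properties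
  using (∈-map⁺; ∈-map⁻; ∈-++⁺ˡ; ∈-++⁺ʳ)
open import Data.List.Relation.Unary.Any using (here)
open import Data.List.Relation.Unary.All using ([])
open import Data.List.Relation.Unary.AllPairs using ([]; _∷_)
open import Data.List.Relation.Unary.Unique.Propositional using (Unique)
open import Data.List.Relation.Unary.Unique.Propositional.Properties
  using (map⁺; ++⁺)
open import Data.Nat.Base as ℕ using (ℕ; zero; suc; NonZero; _!)
import Data.Nat.Properties as ℕ
open import Data.Product.Base using (_×_; _,_; proj₁; ∃)
open import Data.Sum.Base using (_⊎_; inj₁; inj₂)
open import Data.Vec.Base as Vec using (Vec; []; _∷_)
import Data.Vec.Properties as Vec
open import Level using (Level; _⊔_)
open import Relation.Binary.PropositionalEquality
  using (_≡_; _≢_; refl; sym; trans; cong; cong₂)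
open import Relation.Nullary using (¬_)
open import Relation.Nullary.Decidable using (does)

private variable
  c e : Level

-- B m k is the set of exponent vectors in m variables of total degree k.
B : ℕ → ℕ → Set
B m k = ∃ λ (u : Vec ℕ m) → Vec.sum u ≡ k

B-≡ : ∀ {m k} {a b : B m k} → proj₁ a ≡ proj₁ b → a ≡ b
B-≡ {a = u , p} {b = .u , q} refl = cong (u ,_) (ℕ.≡-irrelevant p q)

0∷ᴮ_ : ∀ {m k} → B m k → B (suc m) k
0∷ᴮ (u , p) = 0 ∷ u , p

sucHead : ∀ {m k} → B (suc m) k → B (suc m) (suc k)
sucHead (a ∷ u , p) = suc a ∷ u , cong suc p

allB : ∀ m k → List (B m k)
allB zero    zero    = ([] , refl) ∷ []
allB zero    (suc k) = []
allB (suc m) zero    = List.map 0∷ᴮ_ (allB m zero)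
allB (suc m) (suc k) =
  List.map 0∷ᴮ_ (allB m (suc k)) ++ List.map sucHead (allB (suc m) k)

allB-complete : ∀ {m k} (b : B m k) → b ∈ allB m k
allB-complete {zero}  {zero}  ([] , refl)      = here refl
allB-complete {suc m} {zero}  (zero ∷ u , p)   = ∈-map⁺ 0∷ᴮ_ (allB-complete (u , p))
allB-complete {suc m} {suc k} (zero ∷ u , p)   =
  ∈-++⁺ˡ (∈-map⁺ 0∷ᴮ_ (allB-complete (u , p)))
allB-complete {suc m} {suc k} (suc a ∷ u , refl) =
  ∈-++⁺ʳ (List.map 0∷ᴮ_ (allB m (suc k)))
         (∈-map⁺ sucHead (allB-complete (a ∷ u , refl)))

allB-unique : ∀ m k → Unique (allB m k)
allB-unique zero    zero    = [] ∷ []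
allB-unique zero    (suc k) = []
allB-unique (suc m) zero    = map⁺ 0∷ᴮ-injective (allB-unique m zero)
  where
  0∷ᴮ-injective : ∀ {a b : B m zero} → 0∷ᴮ a ≡ 0∷ᴮ b → a ≡ b
  0∷ᴮ-injective q = B-≡ (Vec.∷-injectiveʳ (cong proj₁ q))
allB-unique (suc m) (suc k) =
  ++⁺ (map⁺ 0∷ᴮ-injective (allB-unique m (suc k)))
      (map⁺ sucHead-injective (allB-unique (suc m) k))
      disjoint
  where
  0∷ᴮ-injective : ∀ {a b : B m (suc k)} → 0∷ᴮ a ≡ 0∷ᴮ b → a ≡ b
  0∷ᴮ-injective q = B-≡ (Vec.∷-injectiveʳ (cong proj₁ q))
  sucHead-injective : ∀ {a b : B (suc m) k} → sucHead a ≡ sucHead b → a ≡ b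
  sucHead-injective {_ ∷ _ , _} {_ ∷ _ , _} q =
    B-≡ (cong₂ _∷_ (ℕ.suc-injective (Vec.∷-injectiveˡ (cong proj₁ q)))
                   (Vec.∷-injectiveʳ (cong proj₁ q)))
  0∷≢sucHead : (a : B m (suc k)) (b : B (suc m) k) → 0∷ᴮ a ≢ sucHead b
  0∷≢sucHead _ (_ ∷ _ , _) q with Vec.∷-injectiveˡ (cong proj₁ q)
  ... | ()
  disjoint : ∀ {x} → ¬ (x ∈ List.map 0∷ᴮ_ (allB m (suc k)) ×
                        x ∈ List.map sucHead (allB (suc m) k))
  disjoint (x∈l , x∈r) with ∈-map⁻ 0∷ᴮ_ x∈l | ∈-map⁻ sucHead x∈r
  ... | a , _ , x≡a | b , _ , x≡b = 0∷≢sucHead a b (trans (sym x≡a) x≡b)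

record IsIntegralDomain (R : CommutativeRing c e) : Set (c ⊔ e) where
  open CommutativeRing R
  field
    1≉0             : 1# ≉ 0#
    no-zero-divisor : ∀ x y → x * y ≈ 0# → x ≈ 0# ⊎ y ≈ 0#

CharacteristicZero : CommutativeRing c e → Set e
CharacteristicZero R = ∀ m → m ×ᴿ 1# ≈ 0# → m ≡ 0
  where
  open CommutativeRing R
  open RawSemiringOps (Semiring.rawSemiring semiring) using () renaming (_×_ to _×ᴿ_)

-- Vectors and square matrices with entries in S, indexed by B m h.
module Matrices (S : RawSemiring c e) (m h : ℕ) where
  open RawSemiring S

  Vector Matrix : Set c
  Vector = B m h → Carrier
  Matrix = B m h → B m h → Carrier

  infix 4 _≈ⱽ_
  _≈ⱽ_ : Vector → Vector → Set e
  x ≈ⱽ y = ∀ t → x t ≈ y t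

  ∑ : (B m h → Carrier) → Carrier
  ∑ f = List.foldr _+_ 0# (List.map f (allB m h))

  infixr 7 _·_ _∙ⱽ_ _⊗_
  _·_ : Carrier → Vector → Vector
  (a · x) t = a * x t

  _∙ⱽ_ : Matrix → Vector → Vector
  (M ∙ⱽ x) t = ∑ λ t′ → M t t′ * x t′

  _⊗_ : Matrix → Matrix → Matrix
  (M ⊗ N) t t″ = ∑ λ t′ → M t t′ * N t′ t″

  identity : Matrix
  identity t t′ =
    if does (Vec.≡-dec ℕ._≟_ (proj₁ t) (proj₁ t′)) then 1# else 0#

  -- descendingProduct M N = M (N - 1) ⊗ ⋯ ⊗ M 1 ⊗ M 0
  descendingProduct : (ℕ → Matrix) → ℕ → Matrix
  descendingProduct M zero    = identity
  descendingProduct M (suc N) = M N ⊗ descendingProduct M N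

module Polynomials (R : CommutativeRing c e) where
  open CommutativeRing R
  open RawSemiringOps (Semiring.rawSemiring semiring) using (_^_) renaming (_×_ to _×ᴿ_)

  fromℕ : ℕ → Carrier
  fromℕ m = m ×ᴿ 1#

  -- A polynomial in m variables is given by a list of terms
  -- (coefficient , exponent vector); exponents may repeat, and the ring
  -- element at each monomial is the total over its occurrences.
  Poly : ℕ → Set c
  Poly m = List (Carrier × Vec ℕ m)

  -- An exponent vector with a negative entry matches no term, so its
  -- coefficient is 0#.
  coeff : ∀ {m} → Poly m → Vec ℤ m → Carrier
  coeff p u = List.foldr _+_ 0# (List.map contribution p)
    where
    contribution : Carrier × Vec ℕ _ → Carrier
    contribution (a , f) =
      if does (Vec.≡-dec ℤ._≟_ (Vec.map +_ f) u) then a else 0#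

  polySemiring : ℕ → RawSemiring c e
  polySemiring m = record
    { Carrier = Poly m
    ; _≈_     = λ p q → ∀ (u : Vec ℕ m) →
                  coeff p (Vec.map +_ u) ≈ coeff q (Vec.map +_ u)
    ; _+_     = _++_
    ; _*_     = List.cartesianProductWith
                  λ (a , f) (b , g) → a * b , Vec.zipWith ℕ._+_ f g
    ; 0#      = []
    ; 1#      = (1# , Vec.replicate m 0) ∷ []
    }

  module _ {m : ℕ} where
    open RawSemiring (polySemiring m) public
      using () renaming (_≈_ to _≈ₚ_; _+_ to _+ₚ_; _*_ to _*ₚ_)
    open RawSemiringOps (polySemiring m) public
      using () renaming (_^_ to _^ₚ_; sum to sumₚ)

  X : ∀ {m} → Fin m → Poly m
  X i = (1# , (Vec.replicate _ 0 Vec.[ i ]≔ 1)) ∷ []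

  Homogeneous : ∀ {m} → ℕ → Poly m → Set e
  Homogeneous k p = ∀ u → Vec.sum u ≢ k → coeff p (Vec.map +_ u) ≈ 0#

  TotalDegree≤ : ∀ {m} → ℕ → Poly m → Set e
  TotalDegree≤ k p = ∀ u → k ℕ.< Vec.sum u → coeff p (Vec.map +_ u) ≈ 0#

  eval : ∀ {m} → Poly m → Vec Carrier m → Carrier
  eval p x = List.foldr _+_ 0# (List.map value p)
    where
    value : Carrier × Vec ℕ _ → Carrier
    value (a , f) = a * Vec.foldr′ _*_ 1# (Vec.zipWith _^_ x f)

  -- x₀ᵈ + ⋯ + xₘ₋₁ᵈ
  powerSum : ∀ m → ℕ → Poly m
  powerSum m d = sumₚ {m} {m} λ i → X i ^ₚ d

  -- coeffVector v w k H is the vector [H]ₖ with entries H_{kv+w-t}.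
  coeffVector : ∀ {m r h} → B m r → B m h → ℕ → Poly m → B m h → Carrier
  coeffVector (v , _) (w , _) k H (t , _) =
    coeff H (Vec.zipWith _⊖_ (Vec.zipWith ℕ._+_ (Vec.map (k ℕ.*_) v) w) t)

  -- A matrix over R[k,ℓ], evaluated at (k₀ , ℓ₀).
  evalMatrix : ∀ {I : Set} → (I → I → Poly 2) → ℕ → ℕ → I → I → Carrier
  evalMatrix Q k₀ ℓ₀ t t′ = eval (Q t t′) (fromℕ k₀ ∷ fromℕ ℓ₀ ∷ [])

module FractionField (R : CommutativeRing c e)
                     (isIntegralDomain : IsIntegralDomain R) where
  open CommutativeRing R
  open IsIntegralDomain isIntegralDomain
  open Polynomials R using (fromℕ)

  record Fraction : Set (c ⊔ e) where
    constructor fraction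
    field
      num   : Carrier
      den   : Carrier
      den≉0 : den ≉ 0#

  open Fraction

  *-≉0 : ∀ {x y} → x ≉ 0# → y ≉ 0# → x * y ≉ 0#
  *-≉0 {x} {y} x≉0 y≉0 xy≈0 with no-zero-divisor x y xy≈0
  ... | inj₁ x≈0 = x≉0 x≈0
  ... | inj₂ y≈0 = y≉0 y≈0

  ι : Carrier → Fraction
  ι x = fraction x 1# 1≉0

  fractionSemiring : RawSemiring (c ⊔ e) e
  fractionSemiring = record
    { Carrier = Fraction
    ; _≈_     = λ p q → num p * den q ≈ num q * den p
    ; _+_     = λ p q → fraction (num p * den q + num q * den p) (den p * den q)
                          (*-≉0 (den≉0 p) (den≉0 q))
    ; _*_     = λ p q → fraction (num p * num q) (den p * den q)
                          (*-≉0 (den≉0 p) (den≉0 q))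
    ; 0#      = ι 0#
    ; 1#      = ι 1#
    }

  reciprocal : CharacteristicZero R → (m : ℕ) → .{{NonZero m}} → Fraction
  reciprocal char0 m =
    fraction 1# (fromℕ m) λ m≈0 → ℕ.≢-nonZero⁻¹ m (char0 m m≈0)

d^N*N!≢0 : ∀ {d} → 1 ℕ.≤ d → ∀ N → NonZero (d ℕ.^ N ℕ.* N !)
d^N*N!≢0 {d} 1≤d N =
  ℕ.m*n≢0 (d ℕ.^ N) (N !) {{ℕ.m^n≢0 d N {{ℕ.>-nonZero 1≤d}}}} {{N ℕ.!≢0}}

{-# OPTIONS --safe #-}
module Submission where

-- Let θ = xᵢ ∂/∂xᵢ. Since θ G = d xᵢᵈ, the Leibniz rule gives
--   F θ(Gᵃ Fᵇ) = a d xᵢᵈ Gᵃ⁻¹ Fᵇ⁺¹ + b (θ F) Gᵃ Fᵇ,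
-- so each coefficient of a d xᵢᵈ Gᵃ⁻¹ Fᵇ⁺¹ is a combination of coefficients of
-- Gᵃ Fᵇ, weighted linearly in their exponents and in b. The bound on h forces
-- tᵢ ≥ d for some i, and with that i the row of Q indexed by t reads off this
-- identity at the exponent kv + w − (t − d eᵢ); homogeneity of F keeps the
-- coefficients involved inside the window kv + w − B_h.

open import Defs
open import Algebra.Bundles using (CommutativeRing; CommutativeSemiring; RawSemiring; Semiring)
import Algebra.Properties.CommutativeSemigroup as CommutativeSemigroupProperties
import Algebra.Properties.AbelianGroup as AbelianGroupProperties
import Algebra.Properties.Ring as RingProperties
import Algebra.Solver.Ring.NaturalCoefficients.Default as SemiringSolver
import Algebra.Properties.Semiring.Mult as SemiringMult
open import Algebra.Structures.Biased using (isCommutativeSemiringˡ; isCommutativeMonoidˡ)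
open import Data.Bool.Base using (if_then_else_; true; false)
open import Data.Fin.Base as Fin using (Fin)
import Data.Fin.Properties as Fin
open import Data.Integer.Base as ℤ using (ℤ)
import Data.Integer.Properties as ℤ
open import Data.List.Base as List using (List; []; _∷_; _++_)
import Data.List.Properties as List
open import Data.List.Membership.Propositional using (_∈_)
open import Data.List.Relation.Unary.All as All using ([]; _∷_)
open import Data.List.Relation.Unary.AllPairs using ([]; _∷_)
open import Data.List.Relation.Unary.Any using (here; there)
open import Data.List.Relation.Unary.Unique.Propositional using (Unique)
open import Data.Nat.Base as ℕ using (ℕ; zero; suc)
import Data.Nat.Properties as ℕ
open import Data.Product.Base using (_×_; _,_; proj₁; proj₂; ∃)
open import Data.Vec.Base as Vec using (Vec; []; _∷_)
import Data.Vec.Properties as Vec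
open import Function.Base using (_∘_)
open import Function.Bundles using (_⇔_; mk⇔)
open import Level using (Level; _⊔_)
open import Relation.Binary.Structures using (IsEquivalence)
open import Relation.Binary.PropositionalEquality as ≡ using (_≡_; _≢_)
import Relation.Binary.Reasoning.Setoid as SetoidReasoning
open import Relation.Nullary using (¬_; yes; no)
open import Relation.Nullary.Decidable using (Dec; does; dec-true; dec-false; does-⇔; map′)

-- The Leibniz rule evaluates F θ(P) - b (θF) P, with P = Gᵃ Fᵇ, through powers; the entries of `Q`
-- come from evaluating it term by term instead. A term x^f of F and a term x^g of P contribute with
-- the factor gᵢ - b fᵢ, in which a no longer occurs. At the exponent kv + w - τ, where τ = t - d
-- eᵢ, the column t′ collects exactly f = t′ - τ and g = kv + w - t′. The factor is therefore affine
-- in k and in b = ℓ, with coefficients fixed by t, t′, v and w: this is the source of the degree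
-- bound and the reason that one matrix serves all k and ℓ. The scalar a d stays on the other side,
-- so the recurrence and its iteration are division-free over R, and a single reciprocal enters at
-- the end.

private variable
  c e a b : Level
  A : Set a
  A′ : Set b
  m : ℕ

-- Exponent vectors.

infixl 6 _⊕_
_⊕_ : Vec ℕ m → Vec ℕ m → Vec ℕ m
_⊕_ = Vec.zipWith ℕ._+_

infix 4 _≟ⱽ_
_≟ⱽ_ : (u v : Vec ℕ m) → Dec (u ≡ v)
_≟ⱽ_ = Vec.≡-dec ℕ._≟_

0ⱽ : Vec ℕ m
0ⱽ = Vec.replicate _ 0

infix 9 _·eᵢ_
_·eᵢ_ : ℕ → Fin m → Vec ℕ m
d ·eᵢ i = 0ⱽ Vec.[ i ]≔ d

⊕-assoc : (u v w : Vec ℕ m) → (u ⊕ v) ⊕ w ≡ u ⊕ (v ⊕ w)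
⊕-assoc = Vec.zipWith-assoc ℕ.+-assoc

⊕-comm : (u v : Vec ℕ m) → u ⊕ v ≡ v ⊕ u
⊕-comm = Vec.zipWith-comm ℕ.+-comm

⊕-identityˡ : (u : Vec ℕ m) → 0ⱽ ⊕ u ≡ u
⊕-identityˡ = Vec.zipWith-identityˡ ℕ.+-identityˡ

-- Finite sums and Kronecker deltas.

module Sums (R : CommutativeRing c e) where
  open CommutativeRing R
  open CommutativeSemigroupProperties +-commutativeSemigroup using (interchange)
  open SetoidReasoning setoid

  -- Unfolds to the same fold as `∑` of `Matrices`, so the lemmas below apply to matrix products
  -- without conversion.
  ∑[_] : List A → (A → Carrier) → Carrier
  ∑[ xs ] f = List.foldr _+_ 0# (List.map f xs)

  ∑-cong : (xs : List A) {f g : A → Carrier} → (∀ x → f x ≈ g x) → ∑[ xs ] f ≈ ∑[ xs ] g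
  ∑-cong []       f≈g = refl
  ∑-cong (x ∷ xs) f≈g = +-cong (f≈g x) (∑-cong xs f≈g)

  ∑-zero : (xs : List A) {f : A → Carrier} → (∀ x → f x ≈ 0#) → ∑[ xs ] f ≈ 0#
  ∑-zero []       f≈0 = refl
  ∑-zero (x ∷ xs) f≈0 = trans (+-cong (f≈0 x) (∑-zero xs f≈0)) (+-identityˡ 0#)

  ∑-+ : (xs : List A) (f g : A → Carrier) →
        ∑[ xs ] (λ x → f x + g x) ≈ ∑[ xs ] f + ∑[ xs ] g
  ∑-+ []       f g = sym (+-identityˡ 0#)
  ∑-+ (x ∷ xs) f g = trans (+-congˡ (∑-+ xs f g)) (interchange _ _ _ _)

  ∑-distribˡ : (xs : List A) (r : Carrier) (f : A → Carrier) →
               r * ∑[ xs ] f ≈ ∑[ xs ] (λ x → r * f x)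
  ∑-distribˡ []       r f = zeroʳ r
  ∑-distribˡ (x ∷ xs) r f = trans (distribˡ _ _ _) (+-congˡ (∑-distribˡ xs r f))

  ∑-distribʳ : (xs : List A) (r : Carrier) (f : A → Carrier) →
               ∑[ xs ] f * r ≈ ∑[ xs ] (λ x → f x * r)
  ∑-distribʳ []       r f = zeroˡ r
  ∑-distribʳ (x ∷ xs) r f = trans (distribʳ _ _ _) (+-congˡ (∑-distribʳ xs r f))

  ∑-++ : (xs ys : List A) (f : A → Carrier) → ∑[ xs ++ ys ] f ≈ ∑[ xs ] f + ∑[ ys ] f
  ∑-++ []       ys f = sym (+-identityˡ _)
  ∑-++ (x ∷ xs) ys f = trans (+-congˡ (∑-++ xs ys f)) (sym (+-assoc _ _ _))

  ∑-swap : (xs : List A) (ys : List A′) (f : A → A′ → Carrier) →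
           ∑[ xs ] (λ x → ∑[ ys ] (f x)) ≈ ∑[ ys ] (λ y → ∑[ xs ] (λ x → f x y))
  ∑-swap []       ys f = sym (∑-zero ys λ _ → refl)
  ∑-swap (x ∷ xs) ys f = trans (+-congˡ (∑-swap xs ys f)) (sym (∑-+ ys _ _))

  ∑-single : {xs : List A} {x : A} {f : A → Carrier} → Unique xs → x ∈ xs →
             (∀ y → x ≢ y → f y ≈ 0#) → ∑[ xs ] f ≈ f x
  ∑-single {x = x} {f} (x∉xs ∷ _) (here ≡.refl) f≈0 =
    trans (+-congˡ (go x∉xs)) (+-identityʳ _)
    where
    go : ∀ {ys} → All.All (x ≢_) ys → ∑[ ys ] f ≈ 0#
    go []         = refl
    go (x≢y ∷ x∉) = trans (+-cong (f≈0 _ x≢y) (go x∉)) (+-identityˡ 0#)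
  ∑-single {x = x} (y∉xs ∷ xs!) (there x∈xs) f≈0 =
    trans (+-cong (f≈0 _ λ x≡y → All.lookup y∉xs x∈xs (≡.sym x≡y)) (∑-single xs! x∈xs f≈0))
          (+-identityˡ _)

module Indicators (R : CommutativeRing c e) where
  open CommutativeRing R

  ⟦_⟧ : {P : Set a} → Dec P → Carrier
  ⟦ p? ⟧ = if does p? then 1# else 0#

  δ : Vec ℕ m → Vec ℕ m → Carrier
  δ u v = ⟦ u ≟ⱽ v ⟧

  ⟦⟧-true : {P : Set a} (p? : Dec P) → P → ⟦ p? ⟧ ≈ 1#
  ⟦⟧-true p? p rewrite dec-true p? p = refl

  ⟦⟧-false : {P : Set a} (p? : Dec P) → ¬ P → ⟦ p? ⟧ ≈ 0#
  ⟦⟧-false p? ¬p rewrite dec-false p? ¬p = refl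

  *-⟦⟧-false : {P : Set a} (x : Carrier) (p? : Dec P) → ¬ P → x * ⟦ p? ⟧ ≈ 0#
  *-⟦⟧-false x p? ¬p = trans (*-congˡ (⟦⟧-false p? ¬p)) (zeroʳ x)

  ⟦⟧-cong : {P : Set a} {Q : Set b} (p? : Dec P) (q? : Dec Q) → P ⇔ Q → ⟦ p? ⟧ ≈ ⟦ q? ⟧
  ⟦⟧-cong p? q? P⇔Q rewrite does-⇔ P⇔Q p? q? = refl

  -- Lets a weight be rewritten under the equation that its delta enforces; away from that equation
  -- both products vanish.
  δ-*-cong : {u v : Vec ℕ m} {x y : Carrier} → (u ≡ v → x ≈ y) → x * δ u v ≈ y * δ u v
  δ-*-cong {u = u} {v} x≈y with u ≟ⱽ v
  ... | yes u≡v = *-congʳ (x≈y u≡v)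
  ... | no  u≢v = trans (zeroʳ _) (sym (zeroʳ _))

-- Polynomials as term lists, tested against functionals on exponents.

module PolynomialAlgebra (R : CommutativeRing c e) where
  open CommutativeRing R
  open Polynomials R
  open Sums R
  open Indicators R
  open CommutativeSemigroupProperties *-commutativeSemigroup using (x∙yz≈y∙xz)
  open SetoidReasoning setoid

  Functional : ℕ → Set c
  Functional m = Vec ℕ m → Carrier

  -- The linear extension of φ from monomials to polynomials. Coefficients are pairings with deltas,
  -- so repeated exponents in a term list never have to be merged.
  ⟪_,_⟫ : Poly m → Functional m → Carrier
  ⟪ p , φ ⟫ = ∑[ p ] λ (a , f) → a * φ f

  ⟪⟫-cong : (p : Poly m) {φ ψ : Functional m} → (∀ f → φ f ≈ ψ f) → ⟪ p , φ ⟫ ≈ ⟪ p , ψ ⟫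
  ⟪⟫-cong p φ≈ψ = ∑-cong p λ (a , f) → *-congˡ (φ≈ψ f)

  ⟪⟫-zero : (p : Poly m) {φ : Functional m} → (∀ f → φ f ≈ 0#) → ⟪ p , φ ⟫ ≈ 0#
  ⟪⟫-zero p φ≈0 = ∑-zero p λ (a , f) → trans (*-congˡ (φ≈0 f)) (zeroʳ a)

  ⟪⟫-+ : (p : Poly m) (φ ψ : Functional m) →
         ⟪ p , (λ f → φ f + ψ f) ⟫ ≈ ⟪ p , φ ⟫ + ⟪ p , ψ ⟫
  ⟪⟫-+ p φ ψ = trans (∑-cong p λ (a , f) → distribˡ a _ _) (∑-+ p _ _)

  ⟪⟫-scale : (p : Poly m) (r : Carrier) (φ : Functional m) →
             ⟪ p , (λ f → r * φ f) ⟫ ≈ r * ⟪ p , φ ⟫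
  ⟪⟫-scale p r φ =
    trans (∑-cong p λ (a , f) → x∙yz≈y∙xz a r (φ f)) (sym (∑-distribˡ p r _))

  ⟪⟫-∑ : (p : Poly m) (xs : List A) (φ : A → Functional m) →
         ⟪ p , (λ f → ∑[ xs ] λ x → φ x f) ⟫ ≈ ∑[ xs ] λ x → ⟪ p , φ x ⟫
  ⟪⟫-∑ p xs φ = trans (∑-cong p λ (a , f) → ∑-distribˡ xs a _) (∑-swap p xs _)

  ⟪⟫-swap : (p q : Poly m) (φ : Vec ℕ m → Functional m) →
            ⟪ p , (λ f → ⟪ q , φ f ⟫) ⟫ ≈ ⟪ q , (λ g → ⟪ p , (λ f → φ f g) ⟫) ⟫
  ⟪⟫-swap p q φ = trans (⟪⟫-∑ p q _) (∑-cong q λ (b , g) → ⟪⟫-scale p b _)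

  ⟪⟫-monomial : (f : Vec ℕ m) (φ : Functional m) → ⟪ (1# , f) ∷ [] , φ ⟫ ≈ φ f
  ⟪⟫-monomial f φ = trans (+-identityʳ _) (*-identityˡ _)

  -- Reduces each ring law for term lists to the corresponding law of `⊕` and to exchanging two
  -- sums.
  ⟪⟫-* : (p q : Poly m) (φ : Functional m) →
         ⟪ p *ₚ q , φ ⟫ ≈ ⟪ p , (λ f → ⟪ q , (λ g → φ (f ⊕ g)) ⟫) ⟫
  ⟪⟫-* []            q φ = refl
  ⟪⟫-* ((a , f) ∷ p) q φ =
    trans (∑-++ (List.map _ q) _ _) (+-cong (go q) (⟪⟫-* p q φ))
    where
    go : ∀ q → ⟪ List.map (λ (b , g) → a * b , f ⊕ g) q , φ ⟫ ≈
               a * ⟪ q , (λ g → φ (f ⊕ g)) ⟫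
    go []            = sym (zeroʳ a)
    go ((b , g) ∷ q) = trans (+-cong (*-assoc a b _) (go q)) (sym (distribˡ a _ _))

  -- Equality against every functional, not only the coefficient functionals
  -- as in _≈ₚ_: it makes the congruence and ring laws immediate.
  infix 4 _≋_
  record _≋_ {m : ℕ} (p q : Poly m) : Set (c ⊔ e) where
    constructor mk≋
    field pairing : ∀ φ → ⟪ p , φ ⟫ ≈ ⟪ q , φ ⟫
  open _≋_ public

  *ₚ-cong : {p p′ q q′ : Poly m} → p ≋ p′ → q ≋ q′ → p *ₚ q ≋ p′ *ₚ q′
  *ₚ-cong {p = p} {p′} {q} {q′} p≋p′ q≋q′ .pairing φ = begin
    ⟪ p *ₚ q , φ ⟫                             ≈⟨ ⟪⟫-* p q φ ⟩
    ⟪ p , (λ f → ⟪ q , (λ g → φ (f ⊕ g)) ⟫) ⟫   ≈⟨ pairing p≋p′ _ ⟩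
    ⟪ p′ , (λ f → ⟪ q , (λ g → φ (f ⊕ g)) ⟫) ⟫  ≈⟨ ⟪⟫-cong p′ (λ f → pairing q≋q′ _) ⟩
    ⟪ p′ , (λ f → ⟪ q′ , (λ g → φ (f ⊕ g)) ⟫) ⟫ ≈⟨ ⟪⟫-* p′ q′ φ ⟨
    ⟪ p′ *ₚ q′ , φ ⟫                           ∎

  *ₚ-assoc : (p q r : Poly m) → (p *ₚ q) *ₚ r ≋ p *ₚ (q *ₚ r)
  *ₚ-assoc p q r .pairing φ = begin
    ⟪ (p *ₚ q) *ₚ r , φ ⟫
      ≈⟨ ⟪⟫-* (p *ₚ q) r φ ⟩
    ⟪ p *ₚ q , (λ f → ⟪ r , (λ h → φ (f ⊕ h)) ⟫) ⟫
      ≈⟨ ⟪⟫-* p q _ ⟩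
    ⟪ p , (λ f → ⟪ q , (λ g → ⟪ r , (λ h → φ ((f ⊕ g) ⊕ h)) ⟫) ⟫) ⟫
      ≈⟨ (⟪⟫-cong p λ f → ⟪⟫-cong q λ g → ⟪⟫-cong r λ h → reflexive (≡.cong φ (⊕-assoc f g h))) ⟩
    ⟪ p , (λ f → ⟪ q , (λ g → ⟪ r , (λ h → φ (f ⊕ (g ⊕ h))) ⟫) ⟫) ⟫
      ≈⟨ (⟪⟫-cong p λ f → ⟪⟫-* q r _) ⟨
    ⟪ p , (λ f → ⟪ q *ₚ r , (λ g → φ (f ⊕ g)) ⟫) ⟫
      ≈⟨ ⟪⟫-* p (q *ₚ r) φ ⟨
    ⟪ p *ₚ (q *ₚ r) , φ ⟫ ∎

  *ₚ-comm : (p q : Poly m) → p *ₚ q ≋ q *ₚ p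
  *ₚ-comm p q .pairing φ = begin
    ⟪ p *ₚ q , φ ⟫                            ≈⟨ ⟪⟫-* p q φ ⟩
    ⟪ p , (λ f → ⟪ q , (λ g → φ (f ⊕ g)) ⟫) ⟫  ≈⟨ ⟪⟫-swap p q _ ⟩
    ⟪ q , (λ g → ⟪ p , (λ f → φ (f ⊕ g)) ⟫) ⟫
      ≈⟨ (⟪⟫-cong q λ g → ⟪⟫-cong p λ f → reflexive (≡.cong φ (⊕-comm f g))) ⟩
    ⟪ q , (λ g → ⟪ p , (λ f → φ (g ⊕ f)) ⟫) ⟫  ≈⟨ ⟪⟫-* q p φ ⟨
    ⟪ q *ₚ p , φ ⟫                            ∎

  -- Only a semiring: subtraction is carried out in R, after pairing. The bundle gives access to the
  -- generic theory of multiples and rearrangements.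
  polynomials : ℕ → CommutativeSemiring c (c ⊔ e)
  polynomials m = record
    { Carrier = Poly m
    ; _≈_     = _≋_
    ; _+_     = _+ₚ_
    ; _*_     = _*ₚ_
    ; 0#      = []
    ; 1#      = (1# , 0ⱽ) ∷ []
    ; isCommutativeSemiring = isCommutativeSemiringˡ record
      { +-isCommutativeMonoid = isCommutativeMonoidˡ record
        { isSemigroup = record
          { isMagma = record
            { isEquivalence = isEquivalenceₚ
            ; ∙-cong        = λ {p} {p′} {q} {q′} p≋p′ q≋q′ → mk≋ λ φ →
                trans (∑-++ p q _)
                  (trans (+-cong (pairing p≋p′ φ) (pairing q≋q′ φ)) (sym (∑-++ p′ q′ _)))
            }
          ; assoc   = λ p q r → mk≋ λ φ → begin
              ⟪ (p +ₚ q) +ₚ r , φ ⟫              ≈⟨ ∑-++ (p +ₚ q) r _ ⟩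
              ⟪ p +ₚ q , φ ⟫ + ⟪ r , φ ⟫         ≈⟨ +-congʳ (∑-++ p q _) ⟩
              ⟪ p , φ ⟫ + ⟪ q , φ ⟫ + ⟪ r , φ ⟫   ≈⟨ +-assoc _ _ _ ⟩
              ⟪ p , φ ⟫ + (⟪ q , φ ⟫ + ⟪ r , φ ⟫) ≈⟨ +-congˡ (∑-++ q r _) ⟨
              ⟪ p , φ ⟫ + ⟪ q +ₚ r , φ ⟫         ≈⟨ ∑-++ p (q +ₚ r) _ ⟨
              ⟪ p +ₚ (q +ₚ r) , φ ⟫              ∎
          }
        ; identityˡ = λ p → mk≋ λ φ → refl
        ; comm      = λ p q → mk≋ λ φ →
            trans (∑-++ p q _) (trans (+-comm _ _) (sym (∑-++ q p _)))
        }
      ; *-isCommutativeMonoid = isCommutativeMonoidˡ record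
        { isSemigroup = record
          { isMagma = record { isEquivalence = isEquivalenceₚ ; ∙-cong = *ₚ-cong }
          ; assoc   = *ₚ-assoc
          }
        ; identityˡ = λ p → mk≋ λ φ →
            trans (⟪⟫-* ((1# , 0ⱽ) ∷ []) p φ)
              (trans (⟪⟫-monomial 0ⱽ λ f → ⟪ p , (λ g → φ (f ⊕ g)) ⟫)
                (⟪⟫-cong p λ f → reflexive (≡.cong φ (⊕-identityˡ f))))
        ; comm      = *ₚ-comm
        }
      ; distribʳ = λ r p q → mk≋ λ φ → begin
          ⟪ (p +ₚ q) *ₚ r , φ ⟫              ≈⟨ ⟪⟫-* (p +ₚ q) r φ ⟩
          ⟪ p +ₚ q , _ ⟫                     ≈⟨ ∑-++ p q _ ⟩
          ⟪ p , _ ⟫ + ⟪ q , _ ⟫              ≈⟨ +-cong (⟪⟫-* p r φ) (⟪⟫-* q r φ) ⟨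
          ⟪ p *ₚ r , φ ⟫ + ⟪ q *ₚ r , φ ⟫    ≈⟨ ∑-++ (p *ₚ r) (q *ₚ r) _ ⟨
          ⟪ (p *ₚ r) +ₚ (q *ₚ r) , φ ⟫       ∎
      ; zeroˡ    = λ p → mk≋ λ φ → refl
      }
    }
    where
    isEquivalenceₚ : IsEquivalence (_≋_ {m})
    isEquivalenceₚ = record
      { refl  = mk≋ λ φ → refl
      ; sym   = λ p≋q → mk≋ λ φ → sym (pairing p≋q φ)
      ; trans = λ p≋q q≋r → mk≋ λ φ → trans (pairing p≋q φ) (pairing q≋r φ)
      }

-- Euler operators, the Leibniz rule and the polynomial identity behind the recurrence.

module EulerOperators (R : CommutativeRing c e) where
  open CommutativeRing R
  open Polynomials R
  open Sums R
  open PolynomialAlgebra R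
  open SemiringMult semiring using () renaming (×-homo-+ to ×ᴿ-homo-+)
  open CommutativeSemigroupProperties *-commutativeSemigroup using (x∙yz≈y∙xz; xy∙z≈y∙xz)

  private
    module P {m : ℕ} where
      open CommutativeSemiring (polynomials m) public
      open CommutativeSemigroupProperties
        (CommutativeSemiring.*-commutativeSemigroup (polynomials m)) public
        using (x∙yz≈y∙xz; x∙yz≈z∙xy)
    module ≋-Reasoning {m : ℕ} = SetoidReasoning (CommutativeSemiring.setoid (polynomials m))
    module ≈-Reasoning = SetoidReasoning setoid
    module Multₚ {m : ℕ} = SemiringMult (CommutativeSemiring.semiring (polynomials m))
  open Multₚ public using () renaming (_×_ to _×ₚ_)
  open Multₚ using (×-congʳ; ×-comm-*; ×-assoc-*; ×-assocˡ; ×-homo-1)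

  fromℕ-+ : ∀ k l → fromℕ (k ℕ.+ l) ≈ fromℕ k + fromℕ l
  fromℕ-+ = ×ᴿ-homo-+ 1#

  exponent : Fin m → Vec ℕ m → Carrier
  exponent i f = fromℕ (Vec.lookup f i)

  -- The Euler operator xᵢ ∂/∂xᵢ.
  θ : Fin m → Poly m → Poly m
  θ i = List.map λ (a , f) → exponent i f * a , f

  exponent-⊕ : (i : Fin m) (f g : Vec ℕ m) → exponent i (f ⊕ g) ≈ exponent i f + exponent i g
  exponent-⊕ i f g =
    trans (reflexive (≡.cong fromℕ (Vec.lookup-zipWith ℕ._+_ i f g)))
      (fromℕ-+ (Vec.lookup f i) (Vec.lookup g i))

  -- Monomials are eigenvectors of the Euler operator, so it moves over to the functional as
  -- multiplication by the exponent.
  ⟪⟫-θ : (i : Fin m) (p : Poly m) (φ : Functional m) →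
         ⟪ θ i p , φ ⟫ ≈ ⟪ p , (λ f → exponent i f * φ f) ⟫
  ⟪⟫-θ i []            φ = refl
  ⟪⟫-θ i ((a , f) ∷ p) φ = +-cong (xy∙z≈y∙xz _ a (φ f)) (⟪⟫-θ i p φ)

  ⟪⟫-× : (k : ℕ) (p : Poly m) (φ : Functional m) → ⟪ k ×ₚ p , φ ⟫ ≈ fromℕ k * ⟪ p , φ ⟫
  ⟪⟫-× zero    p φ = sym (zeroˡ _)
  ⟪⟫-× (suc k) p φ = begin
    ⟪ p +ₚ k ×ₚ p , φ ⟫                    ≈⟨ ∑-++ p (k ×ₚ p) _ ⟩
    ⟪ p , φ ⟫ + ⟪ k ×ₚ p , φ ⟫             ≈⟨ +-cong (sym (*-identityˡ _)) (⟪⟫-× k p φ) ⟩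
    1# * ⟪ p , φ ⟫ + fromℕ k * ⟪ p , φ ⟫   ≈⟨ distribʳ _ _ _ ⟨
    fromℕ (suc k) * ⟪ p , φ ⟫              ∎
    where open ≈-Reasoning

  θ-cong : (i : Fin m) {p q : Poly m} → p ≋ q → θ i p ≋ θ i q
  θ-cong i {p} {q} p≋q .pairing φ =
    trans (⟪⟫-θ i p φ) (trans (pairing p≋q _) (sym (⟪⟫-θ i q φ)))

  θ-+ : (i : Fin m) (p q : Poly m) → θ i (p +ₚ q) ≋ θ i p +ₚ θ i q
  θ-+ i p q = P.reflexive (List.map-++ _ p q)

  -- The eigenvalue on a monomial is its i-th exponent, and exponents add under multiplication.
  θ-* : (i : Fin m) (p q : Poly m) → θ i (p *ₚ q) ≋ θ i p *ₚ q +ₚ p *ₚ θ i q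
  θ-* i p q .pairing φ = begin
    ⟪ θ i (p *ₚ q) , φ ⟫
      ≈⟨ ⟪⟫-θ i (p *ₚ q) φ ⟩
    ⟪ p *ₚ q , (λ f → exponent i f * φ f) ⟫
      ≈⟨ ⟪⟫-* p q _ ⟩
    ⟪ p , (λ f → ⟪ q , (λ g → exponent i (f ⊕ g) * φ (f ⊕ g)) ⟫) ⟫
      ≈⟨ (⟪⟫-cong p λ f → split f) ⟩
    ⟪ p , (λ f → exponent i f * ⟪ q , (λ g → φ (f ⊕ g)) ⟫ + ⟪ θ i q , (λ g → φ (f ⊕ g)) ⟫) ⟫
      ≈⟨ ⟪⟫-+ p _ _ ⟩
    ⟪ p , (λ f → exponent i f * ⟪ q , (λ g → φ (f ⊕ g)) ⟫) ⟫ +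
    ⟪ p , (λ f → ⟪ θ i q , (λ g → φ (f ⊕ g)) ⟫) ⟫
      ≈⟨ +-cong (⟪⟫-θ i p _) (⟪⟫-* p (θ i q) φ) ⟨
    ⟪ θ i p , (λ f → ⟪ q , (λ g → φ (f ⊕ g)) ⟫) ⟫ + ⟪ p *ₚ θ i q , φ ⟫
      ≈⟨ +-congʳ (⟪⟫-* (θ i p) q φ) ⟨
    ⟪ θ i p *ₚ q , φ ⟫ + ⟪ p *ₚ θ i q , φ ⟫
      ≈⟨ ∑-++ (θ i p *ₚ q) (p *ₚ θ i q) _ ⟨
    ⟪ θ i p *ₚ q +ₚ p *ₚ θ i q , φ ⟫ ∎
    where
    open ≈-Reasoning
    split : ∀ f → ⟪ q , (λ g → exponent i (f ⊕ g) * φ (f ⊕ g)) ⟫ ≈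
                  exponent i f * ⟪ q , (λ g → φ (f ⊕ g)) ⟫ + ⟪ θ i q , (λ g → φ (f ⊕ g)) ⟫
    split f = begin
      ⟪ q , (λ g → exponent i (f ⊕ g) * φ (f ⊕ g)) ⟫
        ≈⟨ (⟪⟫-cong q λ g → trans (*-congʳ (exponent-⊕ i f g)) (distribʳ _ _ _)) ⟩
      ⟪ q , (λ g → exponent i f * φ (f ⊕ g) + exponent i g * φ (f ⊕ g)) ⟫
        ≈⟨ ⟪⟫-+ q _ _ ⟩
      ⟪ q , (λ g → exponent i f * φ (f ⊕ g)) ⟫ + ⟪ q , (λ g → exponent i g * φ (f ⊕ g)) ⟫
        ≈⟨ +-cong (⟪⟫-scale q _ _) (sym (⟪⟫-θ i q _)) ⟩
      exponent i f * ⟪ q , (λ g → φ (f ⊕ g)) ⟫ + ⟪ θ i q , (λ g → φ (f ⊕ g)) ⟫ ∎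

  ⟪⟫-θ-monomial : (i : Fin m) {p : Poly m} {f : Vec ℕ m} → p ≋ (1# , f) ∷ [] →
                  (φ : Functional m) → ⟪ θ i p , φ ⟫ ≈ exponent i f * φ f
  ⟪⟫-θ-monomial i {p} {f} p≋f φ =
    trans (⟪⟫-θ i p φ) (trans (pairing p≋f _) (⟪⟫-monomial f λ f → exponent i f * φ f))

  θ-1 : (i : Fin m) → θ i ((1# , 0ⱽ) ∷ []) ≋ []
  θ-1 i .pairing φ = begin
    ⟪ θ i ((1# , 0ⱽ) ∷ []) , φ ⟫   ≈⟨ ⟪⟫-θ-monomial i P.refl φ ⟩
    exponent i 0ⱽ * φ 0ⱽ           ≡⟨ ≡.cong (λ k → fromℕ k * φ 0ⱽ) (Vec.lookup-replicate i 0) ⟩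
    0# * φ 0ⱽ                      ≈⟨ zeroˡ _ ⟩
    0#                             ∎
    where open ≈-Reasoning

  θ-^ : (i : Fin m) (p : Poly m) (k : ℕ) → θ i (p ^ₚ suc k) ≋ suc k ×ₚ (p ^ₚ k *ₚ θ i p)
  θ-^ i p zero    = begin
    θ i (p *ₚ p ^ₚ 0)        ≈⟨ θ-cong i (P.*-identityʳ p) ⟩
    θ i p                    ≈⟨ P.*-identityˡ (θ i p) ⟨
    p ^ₚ 0 *ₚ θ i p          ≈⟨ ×-homo-1 _ ⟨
    1 ×ₚ (p ^ₚ 0 *ₚ θ i p)   ∎
    where open ≋-Reasoning
  θ-^ i p (suc k) = begin
    θ i (p *ₚ p ^ₚ suc k)
      ≈⟨ θ-* i p (p ^ₚ suc k) ⟩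
    θ i p *ₚ p ^ₚ suc k +ₚ p *ₚ θ i (p ^ₚ suc k)
      ≈⟨ P.+-cong (P.*-comm (θ i p) (p ^ₚ suc k)) (P.*-congˡ {x = p} (θ-^ i p k)) ⟩
    p ^ₚ suc k *ₚ θ i p +ₚ p *ₚ (suc k ×ₚ (p ^ₚ k *ₚ θ i p))
      ≈⟨ P.+-congˡ {x = p ^ₚ suc k *ₚ θ i p} (×-comm-* (suc k) p (p ^ₚ k *ₚ θ i p)) ⟩
    p ^ₚ suc k *ₚ θ i p +ₚ suc k ×ₚ (p *ₚ (p ^ₚ k *ₚ θ i p))
      ≈⟨ P.+-congˡ {x = p ^ₚ suc k *ₚ θ i p} (×-congʳ (suc k) (P.*-assoc p (p ^ₚ k) (θ i p))) ⟨
    suc (suc k) ×ₚ (p ^ₚ suc k *ₚ θ i p) ∎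
    where open ≋-Reasoning

  -- The extra factor `p` makes up for the power lost by differentiation, so the formula includes k
  -- = 0 and involves no exponent k - 1.
  *-θ-^ : (i : Fin m) (p : Poly m) (k : ℕ) → p *ₚ θ i (p ^ₚ k) ≋ k ×ₚ (p ^ₚ k *ₚ θ i p)
  *-θ-^ i p zero    = P.trans (P.*-congˡ {x = p} (θ-1 i)) (P.zeroʳ p)
  *-θ-^ i p (suc k) = begin
    p *ₚ θ i (p ^ₚ suc k)                      ≈⟨ P.*-congˡ {x = p} (θ-^ i p k) ⟩
    p *ₚ (suc k ×ₚ (p ^ₚ k *ₚ θ i p))          ≈⟨ ×-comm-* (suc k) p (p ^ₚ k *ₚ θ i p) ⟩
    suc k ×ₚ (p *ₚ (p ^ₚ k *ₚ θ i p))          ≈⟨ ×-congʳ (suc k) (P.*-assoc p (p ^ₚ k) (θ i p)) ⟨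
    suc k ×ₚ (p ^ₚ suc k *ₚ θ i p)             ∎
    where open ≋-Reasoning

  X-^ : (i : Fin m) (d : ℕ) → X i ^ₚ d ≋ (1# , d ·eᵢ i) ∷ []
  X-^ i zero    = P.reflexive (≡.cong (λ f → (1# , f) ∷ []) (0ⱽ≡ i))
    where
    0ⱽ≡ : (i : Fin m) → 0ⱽ ≡ 0 ·eᵢ i
    0ⱽ≡ Fin.zero    = ≡.refl
    0ⱽ≡ (Fin.suc i) = ≡.cong (0 ∷_) (0ⱽ≡ i)
  X-^ i (suc d) = begin
    X i *ₚ X i ^ₚ d                     ≈⟨ P.*-congˡ {x = X i} (X-^ i d) ⟩
    X i *ₚ ((1# , d ·eᵢ i) ∷ [])        ≡⟨⟩
    (1# * 1# , 1 ·eᵢ i ⊕ d ·eᵢ i) ∷ []  ≡⟨ ≡.cong (λ f → (1# * 1# , f) ∷ []) (⊕-eᵢ i) ⟩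
    (1# * 1# , suc d ·eᵢ i) ∷ []        ≈⟨ (mk≋ λ φ → +-congʳ (*-congʳ (*-identityˡ 1#))) ⟩
    (1# , suc d ·eᵢ i) ∷ []             ∎
    where
    open ≋-Reasoning
    ⊕-eᵢ : (i : Fin m) → 1 ·eᵢ i ⊕ d ·eᵢ i ≡ suc d ·eᵢ i
    ⊕-eᵢ Fin.zero    = ≡.cong (suc d ∷_) (⊕-identityˡ _)
    ⊕-eᵢ (Fin.suc i) = ≡.cong (0 ∷_) (⊕-eᵢ i)

  θ-X-^ : (i : Fin m) (d : ℕ) → θ i (X i ^ₚ d) ≋ d ×ₚ (X i ^ₚ d)
  θ-X-^ i d .pairing φ = begin
    ⟪ θ i (X i ^ₚ d) , φ ⟫                   ≈⟨ ⟪⟫-θ-monomial i (X-^ i d) φ ⟩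
    exponent i (d ·eᵢ i) * φ (d ·eᵢ i)
      ≡⟨ ≡.cong (λ k → fromℕ k * φ (d ·eᵢ i)) (Vec.lookup∘update i 0ⱽ d) ⟩
    fromℕ d * φ (d ·eᵢ i)                    ≈⟨ *-congˡ (⟪⟫-monomial (d ·eᵢ i) φ) ⟨
    fromℕ d * ⟪ (1# , d ·eᵢ i) ∷ [] , φ ⟫    ≈⟨ *-congˡ (pairing (X-^ i d) φ) ⟨
    fromℕ d * ⟪ X i ^ₚ d , φ ⟫               ≈⟨ ⟪⟫-× d (X i ^ₚ d) φ ⟨
    ⟪ d ×ₚ (X i ^ₚ d) , φ ⟫                  ∎
    where open ≈-Reasoning

  θ-X-^-≢ : {i j : Fin m} → i ≢ j → (d : ℕ) → θ i (X j ^ₚ d) ≋ []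
  θ-X-^-≢ {i = i} {j} i≢j d .pairing φ = begin
    ⟪ θ i (X j ^ₚ d) , φ ⟫               ≈⟨ ⟪⟫-θ-monomial i (X-^ j d) φ ⟩
    exponent i (d ·eᵢ j) * φ (d ·eᵢ j)
      ≡⟨ ≡.cong (λ k → fromℕ k * φ (d ·eᵢ j))
           (≡.trans (Vec.lookup∘update′ i≢j 0ⱽ d) (Vec.lookup-replicate i 0)) ⟩
    0# * φ (d ·eᵢ j)                     ≈⟨ zeroˡ _ ⟩
    0#                                   ∎
    where open ≈-Reasoning

  θ-sum-zero : (i : Fin m) {l : ℕ} (p : Fin l → Poly m) →
               (∀ j → θ i (p j) ≋ []) → θ i (sumₚ p) ≋ []
  θ-sum-zero i {zero}  p θp≋0 = P.refl
  θ-sum-zero i {suc l} p θp≋0 =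
    P.trans (θ-+ i (p Fin.zero) _)
      (P.+-cong (θp≋0 Fin.zero) (θ-sum-zero i (p ∘ Fin.suc) (θp≋0 ∘ Fin.suc)))

  θ-sum-single : (i : Fin m) {l : ℕ} (p : Fin l → Poly m) (j : Fin l) →
                 (∀ j′ → j ≢ j′ → θ i (p j′) ≋ []) → θ i (sumₚ p) ≋ θ i (p j)
  θ-sum-single i p Fin.zero    θp≋0 =
    P.trans (θ-+ i (p Fin.zero) _)
      (P.trans (P.+-congˡ {x = θ i (p Fin.zero)}
                 (θ-sum-zero i (p ∘ Fin.suc) λ j → θp≋0 (Fin.suc j) λ ()))
               (P.+-identityʳ (θ i (p Fin.zero))))
  θ-sum-single i p (Fin.suc j) θp≋0 =
    P.trans (θ-+ i (p Fin.zero) _)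
      (P.+-cong (θp≋0 Fin.zero λ ())
        (θ-sum-single i (p ∘ Fin.suc) j λ j′ j≢j′ → θp≋0 (Fin.suc j′) (j≢j′ ∘ Fin.suc-injective)))

  θ-powerSum : (i : Fin m) (d : ℕ) → θ i (powerSum m d) ≋ d ×ₚ (X i ^ₚ d)
  θ-powerSum i d =
    P.trans (θ-sum-single i (λ j → X j ^ₚ d) i λ j i≢j → θ-X-^-≢ i≢j d) (θ-X-^ i d)

  -- Multiplying by `F` serves both Leibniz terms: beside xᵢᵈ it raises Fᵇ to the next power, and in
  -- the other term it restores the power lost in θ(Fᵇ), so that Gᵃ⁺¹ Fᵇ itself reappears there.
  recurrence : (i : Fin m) (d a b : ℕ) (F : Poly m) →
    let G = powerSum m d in
    F *ₚ θ i (G ^ₚ suc a *ₚ F ^ₚ b) ≋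
    (suc a ℕ.* d) ×ₚ (X i ^ₚ d *ₚ (G ^ₚ a *ₚ F ^ₚ suc b)) +ₚ
    b ×ₚ (θ i F *ₚ (G ^ₚ suc a *ₚ F ^ₚ b))
  recurrence {m} i d a b F = begin
    F *ₚ θ i (Gᵃ⁺¹ *ₚ Fᵇ)
      ≈⟨ P.*-congˡ {x = F} (θ-* i Gᵃ⁺¹ Fᵇ) ⟩
    F *ₚ (θ i Gᵃ⁺¹ *ₚ Fᵇ +ₚ Gᵃ⁺¹ *ₚ θ i Fᵇ)
      ≈⟨ P.distribˡ F (θ i Gᵃ⁺¹ *ₚ Fᵇ) (Gᵃ⁺¹ *ₚ θ i Fᵇ) ⟩
    F *ₚ (θ i Gᵃ⁺¹ *ₚ Fᵇ) +ₚ F *ₚ (Gᵃ⁺¹ *ₚ θ i Fᵇ)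
      ≈⟨ P.+-cong onG onF ⟩
    (suc a ℕ.* d) ×ₚ (Xᵈ *ₚ (Gᵃ *ₚ F ^ₚ suc b)) +ₚ b ×ₚ (θ i F *ₚ (Gᵃ⁺¹ *ₚ Fᵇ)) ∎
    where
    open ≋-Reasoning
    G    = powerSum m d
    Gᵃ   = G ^ₚ a
    Gᵃ⁺¹ = G ^ₚ suc a
    Fᵇ   = F ^ₚ b
    Xᵈ   = X i ^ₚ d
    onG : F *ₚ (θ i Gᵃ⁺¹ *ₚ Fᵇ) ≋ (suc a ℕ.* d) ×ₚ (Xᵈ *ₚ (Gᵃ *ₚ F ^ₚ suc b))
    onG = begin
      F *ₚ (θ i Gᵃ⁺¹ *ₚ Fᵇ)
        ≈⟨ P.x∙yz≈y∙xz F (θ i Gᵃ⁺¹) Fᵇ ⟩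
      θ i Gᵃ⁺¹ *ₚ F ^ₚ suc b
        ≈⟨ P.*-congʳ {x = F ^ₚ suc b} (θ-^ i G a) ⟩
      (suc a ×ₚ (Gᵃ *ₚ θ i G)) *ₚ F ^ₚ suc b
        ≈⟨ ×-assoc-* (suc a) (Gᵃ *ₚ θ i G) (F ^ₚ suc b) ⟩
      suc a ×ₚ (Gᵃ *ₚ θ i G *ₚ F ^ₚ suc b)
        ≈⟨ ×-congʳ (suc a) inner ⟩
      suc a ×ₚ (d ×ₚ (Xᵈ *ₚ (Gᵃ *ₚ F ^ₚ suc b)))
        ≈⟨ ×-assocˡ _ (suc a) d ⟩
      (suc a ℕ.* d) ×ₚ (Xᵈ *ₚ (Gᵃ *ₚ F ^ₚ suc b)) ∎
      where
      inner : (Gᵃ *ₚ θ i G) *ₚ F ^ₚ suc b ≋ d ×ₚ (Xᵈ *ₚ (Gᵃ *ₚ F ^ₚ suc b))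
      inner = begin
        (Gᵃ *ₚ θ i G) *ₚ F ^ₚ suc b
          ≈⟨ P.*-congʳ {x = F ^ₚ suc b} (P.*-comm Gᵃ (θ i G)) ⟩
        (θ i G *ₚ Gᵃ) *ₚ F ^ₚ suc b
          ≈⟨ P.*-assoc (θ i G) Gᵃ (F ^ₚ suc b) ⟩
        θ i G *ₚ (Gᵃ *ₚ F ^ₚ suc b)
          ≈⟨ P.*-congʳ {x = Gᵃ *ₚ F ^ₚ suc b} (θ-powerSum i d) ⟩
        (d ×ₚ Xᵈ) *ₚ (Gᵃ *ₚ F ^ₚ suc b)
          ≈⟨ ×-assoc-* d Xᵈ (Gᵃ *ₚ F ^ₚ suc b) ⟩
        d ×ₚ (Xᵈ *ₚ (Gᵃ *ₚ F ^ₚ suc b)) ∎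
    onF : F *ₚ (Gᵃ⁺¹ *ₚ θ i Fᵇ) ≋ b ×ₚ (θ i F *ₚ (Gᵃ⁺¹ *ₚ Fᵇ))
    onF = begin
      F *ₚ (Gᵃ⁺¹ *ₚ θ i Fᵇ)              ≈⟨ P.x∙yz≈y∙xz F Gᵃ⁺¹ (θ i Fᵇ) ⟩
      Gᵃ⁺¹ *ₚ (F *ₚ θ i Fᵇ)              ≈⟨ P.*-congˡ {x = Gᵃ⁺¹} (*-θ-^ i F b) ⟩
      Gᵃ⁺¹ *ₚ (b ×ₚ (Fᵇ *ₚ θ i F))       ≈⟨ ×-comm-* b Gᵃ⁺¹ (Fᵇ *ₚ θ i F) ⟩
      b ×ₚ (Gᵃ⁺¹ *ₚ (Fᵇ *ₚ θ i F))       ≈⟨ ×-congʳ b (P.x∙yz≈z∙xy Gᵃ⁺¹ Fᵇ (θ i F)) ⟩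
      b ×ₚ (θ i F *ₚ (Gᵃ⁺¹ *ₚ Fᵇ))       ∎



-- Differences of exponent vectors, the pigeonhole argument and integer exponents.

∸-⊕-cancel : (u v : Vec ℕ m) → Vec.zipWith ℕ._∸_ (u ⊕ v) v ≡ u
∸-⊕-cancel []      []      = ≡.refl
∸-⊕-cancel (x ∷ u) (y ∷ v) = ≡.cong₂ _∷_ (ℕ.m+n∸n≡m x y) (∸-⊕-cancel u v)

⊕-cancelʳ : (w : Vec ℕ m) {u v : Vec ℕ m} → u ⊕ w ≡ v ⊕ w → u ≡ v
⊕-cancelʳ w {u} {v} eq =
  ≡.trans (≡.sym (∸-⊕-cancel u w))
    (≡.trans (≡.cong (λ x → Vec.zipWith ℕ._∸_ x w) eq) (∸-⊕-cancel v w))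

infix 4 _-ⱽ?_
-- Truncated subtraction produces the only possible difference; adding `v` back tests whether
-- anything was truncated.
_-ⱽ?_ : (u v : Vec ℕ m) → Dec (∃ λ x → u ≡ x ⊕ v)
u -ⱽ? v = map′ (_ ,_)
               (λ { (x , ≡.refl) → ≡.cong (_⊕ v) (≡.sym (∸-⊕-cancel x v)) })
               (u ≟ⱽ Vec.zipWith ℕ._∸_ u v ⊕ v)

⊕-swapʳ : (u v w : Vec ℕ m) → (u ⊕ v) ⊕ w ≡ (u ⊕ w) ⊕ v
⊕-swapʳ u v w =
  ≡.trans (⊕-assoc u v w) (≡.trans (≡.cong (u ⊕_) (⊕-comm v w)) (≡.sym (⊕-assoc u w v)))

sum-⊕ : (u v : Vec ℕ m) → Vec.sum (u ⊕ v) ≡ Vec.sum u ℕ.+ Vec.sum v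
sum-⊕ []      []      = ≡.refl
sum-⊕ (x ∷ u) (y ∷ v) =
  ≡.trans (≡.cong (x ℕ.+ y ℕ.+_) (sum-⊕ u v)) (ℕ-interchange x y (Vec.sum u) (Vec.sum v))
  where open CommutativeSemigroupProperties ℕ.+-commutativeSemigroup
          using () renaming (interchange to ℕ-interchange)

sum-·eᵢ : (d : ℕ) (i : Fin m) → Vec.sum (d ·eᵢ i) ≡ d
sum-·eᵢ {suc m} d Fin.zero = ≡.trans (≡.cong (d ℕ.+_) (sum-0ⱽ m)) (ℕ.+-identityʳ d)
  where
  sum-0ⱽ : ∀ m → Vec.sum (0ⱽ {m}) ≡ 0
  sum-0ⱽ zero    = ≡.refl
  sum-0ⱽ (suc m) = sum-0ⱽ m
sum-·eᵢ d (Fin.suc i) = sum-·eᵢ d i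

-- An entry below d uses up at most d - 1 of the total, so dropping it leaves the tail above its own
-- bound, and the search for an entry of size at least d cannot run out.
pigeonhole : (d : ℕ) (t : Vec ℕ m) → m ℕ.* (d ℕ.∸ 1) ℕ.< Vec.sum t →
             ∃ λ i → ∃ λ τ → t ≡ τ ⊕ d ·eᵢ i
pigeonhole zero    (x ∷ t) _ =
  Fin.zero , x ∷ t ,
  ≡.cong₂ _∷_ (≡.sym (ℕ.+-identityʳ x)) (≡.sym (Vec.zipWith-identityʳ ℕ.+-identityʳ t))
pigeonhole (suc d) (x ∷ t) m*d<∑t with x ℕ.≤? d
... | yes x≤d with pigeonhole (suc d) t
                     (ℕ.≰⇒> λ ∑t≤ → ℕ.<⇒≱ m*d<∑t (ℕ.+-mono-≤ x≤d ∑t≤))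
...   | i , τ , t≡ = Fin.suc i , x ∷ τ , ≡.cong₂ _∷_ (≡.sym (ℕ.+-identityʳ x)) t≡
pigeonhole (suc d) (x ∷ t) m*d<∑t | no x≰d =
  Fin.zero , (x ℕ.∸ suc d) ∷ t ,
  ≡.cong₂ _∷_ (≡.sym (ℕ.m∸n+n≡m (ℕ.≰⇒> x≰d))) (≡.sym (Vec.zipWith-identityʳ ℕ.+-identityʳ t))

toℤⱽ : Vec ℕ m → Vec ℤ m
toℤⱽ = Vec.map λ x → ℤ.+ x

toℤⱽ-injective : (u v : Vec ℕ m) → toℤⱽ u ≡ toℤⱽ v → u ≡ v
toℤⱽ-injective []      []      _  = ≡.refl
toℤⱽ-injective (x ∷ u) (y ∷ v) eq =
  ≡.cong₂ _∷_ (ℤ.+-injective (Vec.∷-injectiveˡ eq)) (toℤⱽ-injective u v (Vec.∷-injectiveʳ eq))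

-- Moving `t` to the other side turns an integer equation into one of natural numbers. If u - t has
-- a negative entry, the latter has no solution f, in agreement with the convention that such
-- coefficients are zero.
toℤⱽ≡⊖⇔ : (f u t : Vec ℕ m) → (toℤⱽ f ≡ Vec.zipWith ℤ._⊖_ u t) ⇔ (u ≡ f ⊕ t)
toℤⱽ≡⊖⇔ f u t = mk⇔ (to f u t) λ { ≡.refl → from f t }
  where
  to : ∀ {m} (f u t : Vec ℕ m) → toℤⱽ f ≡ Vec.zipWith ℤ._⊖_ u t → u ≡ f ⊕ t
  to []      []      []      _  = ≡.refl
  to (x ∷ f) (y ∷ u) (z ∷ t) eq =
    ≡.cong₂ _∷_ (ℤ.+-injective (begin
                  -- `ℤ.+ y` computes to the same value as `y ⊖ 0`, so `z` can be added to both
                  -- arguments.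
                  ℤ.+ y                    ≡⟨ ℤ.+-cancelˡ-⊖ z y 0 ⟨
                  (z ℕ.+ y) ℤ.⊖ (z ℕ.+ 0)  ≡⟨ ≡.cong₂ ℤ._⊖_ (ℕ.+-comm z y) (ℕ.+-identityʳ z) ⟩
                  (y ℕ.+ z) ℤ.⊖ z          ≡⟨ ℤ.distribˡ-⊖-+-pos z y z ⟨
                  (y ℤ.⊖ z) ℤ.+ ℤ.+ z      ≡⟨ ≡.cong (ℤ._+ ℤ.+ z) (Vec.∷-injectiveˡ eq) ⟨
                  ℤ.+ (x ℕ.+ z)            ∎))
                (to f u t (Vec.∷-injectiveʳ eq))
    where open ≡.≡-Reasoning
  from : ∀ {m} (f t : Vec ℕ m) → toℤⱽ f ≡ Vec.zipWith ℤ._⊖_ (f ⊕ t) t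
  from []      []      = ≡.refl
  from (x ∷ f) (z ∷ t) =
    ≡.cong₂ _∷_ (begin
                  ℤ.+ x                    ≡⟨ ℤ.+-cancelˡ-⊖ z x 0 ⟨
                  (z ℕ.+ x) ℤ.⊖ (z ℕ.+ 0)  ≡⟨ ≡.cong₂ ℤ._⊖_ (ℕ.+-comm z x) (ℕ.+-identityʳ z) ⟩
                  (x ℕ.+ z) ℤ.⊖ z          ∎)
                (from f t)
    where open ≡.≡-Reasoning

-- Coefficients as pairings with deltas.

module Coefficients (R : CommutativeRing c e) where
  open CommutativeRing R
  open Polynomials R
  open Indicators R
  open PolynomialAlgebra R

  -- The reindexing `h` allows one proof for both kinds of index: an exponent vector, and a
  -- difference with possibly negative entries.
  coeff-pairing : (p : Poly m) {z : Vec ℤ m} {u : Vec ℕ m} (h : Vec ℕ m → Vec ℕ m) →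
                  (∀ f → (toℤⱽ f ≡ z) ⇔ (u ≡ h f)) →
                  coeff p z ≈ ⟪ p , (λ f → δ u (h f)) ⟫
  coeff-pairing []            h z⇔u = refl
  coeff-pairing ((a , f) ∷ p) {z} {u} h z⇔u =
    +-cong (trans (if-* (Vec.≡-dec ℤ._≟_ (toℤⱽ f) z))
                  (*-congˡ (⟦⟧-cong (Vec.≡-dec ℤ._≟_ (toℤⱽ f) z) (u ≟ⱽ h f) (z⇔u f))))
           (coeff-pairing p h z⇔u)
    where
    if-* : {P : Set} (p? : Dec P) → (if does p? then a else 0#) ≈ a * ⟦ p? ⟧
    if-* p? with does p?
    ... | true  = sym (*-identityʳ a)
    ... | false = sym (zeroʳ a)

  coeff-ℕ : (p : Poly m) (u : Vec ℕ m) → coeff p (toℤⱽ u) ≈ ⟪ p , δ u ⟫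
  coeff-ℕ p u = coeff-pairing p (λ f → f) λ f →
    mk⇔ (λ eq → ≡.sym (toℤⱽ-injective f u eq)) λ eq → ≡.cong toℤⱽ (≡.sym eq)

  coeff-⊖ : (p : Poly m) (u t : Vec ℕ m) →
            coeff p (Vec.zipWith ℤ._⊖_ u t) ≈ ⟪ p , (λ f → δ u (f ⊕ t)) ⟫
  coeff-⊖ p u t = coeff-pairing p (_⊕ t) λ f → toℤⱽ≡⊖⇔ f u t

  totalDegree-terms : (k : ℕ) {p : Poly m} → All.All (λ (a , f) → Vec.sum f ℕ.≤ k) p →
                      TotalDegree≤ k p
  totalDegree-terms k {p} deg≤k u k<∑u = trans (coeff-ℕ p u) (go deg≤k)
    where
    go : ∀ {p} → All.All (λ (a , f) → Vec.sum f ℕ.≤ k) p → ⟪ p , δ u ⟫ ≈ 0#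
    go []            = refl
    go {(a , f) ∷ p} (∑f≤k ∷ deg≤k) =
      trans (+-cong (*-⟦⟧-false a (u ≟ⱽ f) λ { ≡.refl → ℕ.<⇒≱ k<∑u ∑f≤k })
                    (go deg≤k))
            (+-identityˡ 0#)

  -- The pairing is the coefficient of `p` at u - τ, which is either no exponent vector at all or
  -- one of degree different from d.
  homogeneous-shift : {d : ℕ} {p : Poly m} → Homogeneous d p → (τ u : Vec ℕ m) →
                      Vec.sum u ≢ d ℕ.+ Vec.sum τ → ⟪ p , (λ f → δ u (f ⊕ τ)) ⟫ ≈ 0#
  homogeneous-shift {p = p} hom τ u ∑u≢ with u -ⱽ? τ
  ... | no  ∄x          = ⟪⟫-zero p λ f → ⟦⟧-false (u ≟ⱽ (f ⊕ τ)) λ eq → ∄x (f , eq)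
  ... | yes (x , ≡.refl) =
    trans (⟪⟫-cong p λ f → ⟦⟧-cong ((x ⊕ τ) ≟ⱽ (f ⊕ τ)) (x ≟ⱽ f)
             (mk⇔ (⊕-cancelʳ τ) (≡.cong (_⊕ τ))))
      (trans (sym (coeff-ℕ p x))
        (hom x λ ∑x≡d → ∑u≢ (≡.trans (sum-⊕ x τ) (≡.cong (ℕ._+ Vec.sum τ) ∑x≡d))))

-- One row of `Q`: here the row index is τ + d eᵢ.

module Row (R : CommutativeRing c e) {m : ℕ} (d : ℕ)
           (F : Polynomials.Poly R m) (homF : Polynomials.Homogeneous R d F)
           (v w : Vec ℕ m) (i : Fin m) (τ : Vec ℕ m) where
  open CommutativeRing R
  open Polynomials R
  open Sums R
  open Indicators R
  open PolynomialAlgebra R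
  open EulerOperators R
  open Coefficients R
  open SetoidReasoning setoid
  open AbelianGroupProperties +-abelianGroup using (xyx⁻¹≈y; ⁻¹-∙-comm)
  open RingProperties ring using (-‿distribˡ-*)

  -- The coefficient of `F` at t - τ, in a form that is zero by itself when t - τ has a negative
  -- entry.
  F-coeff : Vec ℕ m → Carrier
  F-coeff t = ⟪ F , (λ f → δ t (f ⊕ τ)) ⟫

  -- The factor gᵢ - ℓ fᵢ at g = kv + w - t and f = t - τ. The differences are taken in the ring, so
  -- the formula also makes sense where these vectors have negative entries.
  weightAt : Carrier → Carrier → Vec ℕ m → Carrier
  weightAt k ℓ t =
    exponent i v * k + (exponent i w - exponent i t) + (exponent i τ - exponent i t) * ℓ

  entry : Vec ℕ m → Poly 2
  entry t =
    (F-coeff t * exponent i v                  , 1 ∷ 0 ∷ []) ∷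
    (F-coeff t * (exponent i w - exponent i t) , 0 ∷ 0 ∷ []) ∷
    (F-coeff t * (exponent i τ - exponent i t) , 0 ∷ 1 ∷ []) ∷ []

  entry-totalDegree : ∀ t → TotalDegree≤ 1 (entry t)
  entry-totalDegree t =
    totalDegree-terms 1 {entry t} (ℕ.≤-refl ∷ ℕ.z≤n ∷ ℕ.≤-refl ∷ [])

  eval-entry : ∀ k ℓ t → eval (entry t) (k ∷ ℓ ∷ []) ≈ F-coeff t * weightAt k ℓ t
  eval-entry k ℓ t =
    solve 6 (λ a x y z k ℓ →
        a :* x :* (k :* con 1 :* (con 1 :* con 1)) :+
        (a :* y :* (con 1 :* (con 1 :* con 1)) :+
        (a :* z :* (con 1 :* (ℓ :* con 1 :* con 1)) :+ con 0))
        := a :* (x :* k :+ y :+ z :* ℓ))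
      refl (F-coeff t) (exponent i v) (exponent i w - exponent i t)
           (exponent i τ - exponent i t) k ℓ
    where open SemiringSolver commutativeSemiring

  module _ (k ℓ : ℕ) where
    u : Vec ℕ m
    u = Vec.map (k ℕ.*_) v ⊕ w

    weight : Vec ℕ m → Carrier
    weight = weightAt (fromℕ k) (fromℕ ℓ)

    Q-row : Vec ℕ m → Carrier
    Q-row t = eval (entry t) (fromℕ k ∷ fromℕ ℓ ∷ [])

    exponent-u : exponent i u ≈ exponent i v * fromℕ k + exponent i w
    exponent-u = begin
      exponent i u                                      ≈⟨ exponent-⊕ i (Vec.map (k ℕ.*_) v) w ⟩
      exponent i (Vec.map (k ℕ.*_) v) + exponent i w
        ≡⟨ ≡.cong (λ x → fromℕ x + exponent i w) (Vec.lookup-map i (k ℕ.*_) v) ⟩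
      fromℕ (k ℕ.* Vec.lookup v i) + exponent i w      ≈⟨ +-congʳ (×1-homo-* k _) ⟩
      fromℕ k * exponent i v + exponent i w            ≈⟨ +-congʳ (*-comm _ _) ⟩
      exponent i v * fromℕ k + exponent i w            ∎
      where open SemiringMult semiring using (×1-homo-*)

    -- Once the column t is fixed, the two equations determine both factors of the monomial, which
    -- is why a weight depending on f and g can be expressed by t alone.
    weight-⊕ : {t f g : Vec ℕ m} → u ≡ t ⊕ g → t ≡ f ⊕ τ →
               weight t ≈ exponent i g - exponent i f * fromℕ ℓ
    weight-⊕ {t} {f} {g} u≡t⊕g t≡f⊕τ =
      +-cong constant (trans (*-congʳ linear) (sym (-‿distribˡ-* _ _)))
      where
      constant : exponent i v * fromℕ k + (exponent i w - exponent i t) ≈ exponent i g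
      constant = begin
        exponent i v * fromℕ k + (exponent i w - exponent i t) ≈⟨ +-assoc _ _ _ ⟨
        exponent i v * fromℕ k + exponent i w - exponent i t   ≈⟨ +-congʳ exponent-u ⟨
        exponent i u - exponent i t
          ≡⟨ ≡.cong (λ x → exponent i x - exponent i t) u≡t⊕g ⟩
        exponent i (t ⊕ g) - exponent i t                      ≈⟨ +-congʳ (exponent-⊕ i t g) ⟩
        exponent i t + exponent i g - exponent i t             ≈⟨ xyx⁻¹≈y _ _ ⟩
        exponent i g                                           ∎
      linear : exponent i τ - exponent i t ≈ - exponent i f
      linear = begin
        exponent i τ - exponent i t
          ≡⟨ ≡.cong (λ x → exponent i τ - exponent i x) t≡f⊕τ ⟩
        exponent i τ - exponent i (f ⊕ τ)
          ≈⟨ +-congˡ (-‿cong (trans (exponent-⊕ i f τ) (+-comm _ _))) ⟩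
        exponent i τ - (exponent i τ + exponent i f)     ≈⟨ +-congˡ (⁻¹-∙-comm _ _) ⟨
        exponent i τ + (- exponent i τ - exponent i f)   ≈⟨ +-assoc _ _ _ ⟨
        exponent i τ - exponent i τ - exponent i f       ≈⟨ +-congʳ (-‿inverseʳ _) ⟩
        0# - exponent i f                                ≈⟨ +-identityˡ _ ⟩
        - exponent i f                                   ∎

    -- Pairing with this functional takes the coefficient at kv + w - τ.
    φ : Functional m
    φ f = δ u (f ⊕ τ)

    -- The coefficient of F θ(P) - ℓ (θF) P at kv + w - τ is linear in P; this is its value on the
    -- monomial P = x^g.
    kernel : Vec ℕ m → Carrier
    kernel g = ⟪ F , (λ f → (exponent i g - exponent i f * fromℕ ℓ) * φ (f ⊕ g)) ⟫

    -- Cancelling g from u = f + g + τ leaves t = f + τ, so only one exponent f survives and the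
    -- weight becomes a constant that can be pulled out.
    kernel-⊕ : {t g : Vec ℕ m} → u ≡ t ⊕ g → kernel g ≈ F-coeff t * weight t
    kernel-⊕ {t} {g} u≡t⊕g = begin
      kernel g
        ≈⟨ (⟪⟫-cong F λ f → *-congˡ (⟦⟧-cong (u ≟ⱽ ((f ⊕ g) ⊕ τ)) (t ≟ⱽ (f ⊕ τ))
              (mk⇔ (λ eq → ⊕-cancelʳ g (≡.trans (≡.sym u≡t⊕g) (≡.trans eq (⊕-swapʳ f g τ))))
                   (λ eq → ≡.trans u≡t⊕g (≡.trans (≡.cong (_⊕ g) eq) (⊕-swapʳ f τ g)))))) ⟩
      ⟪ F , (λ f → (exponent i g - exponent i f * fromℕ ℓ) * δ t (f ⊕ τ)) ⟫
        ≈⟨ (⟪⟫-cong F λ f → δ-*-cong λ t≡ → sym (weight-⊕ u≡t⊕g t≡)) ⟩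
      ⟪ F , (λ f → weight t * δ t (f ⊕ τ)) ⟫
        ≈⟨ ⟪⟫-scale F _ _ ⟩
      weight t * F-coeff t
        ≈⟨ *-comm _ _ ⟩
      F-coeff t * weight t ∎

    module _ (h : ℕ) (d+∑τ≡h : d ℕ.+ Vec.sum τ ≡ h) where

      -- Only the column t = u - g can contribute. If u - g is not an exponent vector, the kernel
      -- vanishes too, because u = f + g + τ would exhibit f + τ as that difference.
      ∑-kernel : ∀ g →
        ∑[ allB m h ] (λ (t , _) → F-coeff t * weight t * δ u (g ⊕ t)) ≈ kernel g
      ∑-kernel g with u -ⱽ? g
      ... | no ∄t = trans
        (∑-zero (allB m h) λ (t , _) → *-⟦⟧-false _ (u ≟ⱽ (g ⊕ t)) λ eq →
          ∄t (t , ≡.trans eq (⊕-comm g t)))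
        (sym (⟪⟫-zero F λ f → *-⟦⟧-false _ (u ≟ⱽ ((f ⊕ g) ⊕ τ)) λ eq →
          ∄t (f ⊕ τ , ≡.trans eq (⊕-swapʳ f g τ))))
      ... | yes (t , u≡t⊕g) = trans single (sym (kernel-⊕ u≡t⊕g))
        where
        unique : ∀ {t′} → u ≡ g ⊕ t′ → t ≡ t′
        unique {t′} eq = ⊕-cancelʳ g (≡.trans (≡.sym u≡t⊕g) (≡.trans eq (⊕-comm g t′)))
        single : ∑[ allB m h ] (λ (t′ , _) → F-coeff t′ * weight t′ * δ u (g ⊕ t′)) ≈
                 F-coeff t * weight t
        single with Vec.sum t ℕ.≟ h
        ... | yes ∑t≡h = begin
          ∑[ allB m h ] (λ (t′ , _) → F-coeff t′ * weight t′ * δ u (g ⊕ t′))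
            ≈⟨ ∑-single (allB-unique m h) (allB-complete (t , ∑t≡h))
                 (λ (t′ , _) t≢t′ → *-⟦⟧-false _ (u ≟ⱽ (g ⊕ t′)) λ eq → t≢t′ (B-≡ (unique eq))) ⟩
          F-coeff t * weight t * δ u (g ⊕ t)
            ≈⟨ *-congˡ (⟦⟧-true (u ≟ⱽ (g ⊕ t)) (≡.trans u≡t⊕g (⊕-comm t g))) ⟩
          F-coeff t * weight t * 1#
            ≈⟨ *-identityʳ _ ⟩
          F-coeff t * weight t ∎
        -- Here u - g lies outside the index set, so the sum is empty of contributions. The kernel
        -- agrees: t - τ does not have degree h - |τ| = d, and `F` has no such coefficient.
        ... | no ∑t≢h = begin
          ∑[ allB m h ] (λ (t′ , _) → F-coeff t′ * weight t′ * δ u (g ⊕ t′))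
            ≈⟨ (∑-zero (allB m h) λ (t′ , ∑t′≡h) → *-⟦⟧-false _ (u ≟ⱽ (g ⊕ t′)) λ eq →
                 ∑t≢h (≡.trans (≡.cong Vec.sum (unique eq)) ∑t′≡h)) ⟩
          0#
            ≈⟨ zeroˡ _ ⟨
          0# * weight t
            ≈⟨ *-congʳ (homogeneous-shift {p = F} homF τ t λ ∑t≡ → ∑t≢h (≡.trans ∑t≡ d+∑τ≡h)) ⟨
          F-coeff t * weight t ∎

      -- Both sides are linear in `P`, so the comparison reduces to a single monomial x^g, where it
      -- is `∑-kernel`.
      ∑-entry : (P : Poly m) →
        ∑[ allB m h ] (λ (t , _) → Q-row t * coeff P (Vec.zipWith ℤ._⊖_ u t)) ≈
        ⟪ F *ₚ θ i P , φ ⟫ - fromℕ ℓ * ⟪ θ i F *ₚ P , φ ⟫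
      ∑-entry P = begin
        ∑[ allB m h ] (λ (t , _) → Q-row t * coeff P (Vec.zipWith ℤ._⊖_ u t))
          ≈⟨ (∑-cong (allB m h) λ (t , _) → trans
                (*-cong (eval-entry (fromℕ k) (fromℕ ℓ) t) (coeff-⊖ P u t))
                (sym (⟪⟫-scale P _ _))) ⟩
        ∑[ allB m h ] (λ (t , _) → ⟪ P , (λ g → F-coeff t * weight t * δ u (g ⊕ t)) ⟫)
          ≈⟨ ⟪⟫-∑ P (allB m h) _ ⟨
        ⟪ P , (λ g → ∑[ allB m h ] λ (t , _) → F-coeff t * weight t * δ u (g ⊕ t)) ⟫
          ≈⟨ ⟪⟫-cong P ∑-kernel ⟩
        ⟪ P , kernel ⟫
          ≈⟨ ⟪⟫-swap P F _ ⟩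
        ⟪ F , (λ f → ⟪ P , (λ g → (exponent i g - exponent i f * fromℕ ℓ) * φ (f ⊕ g)) ⟫) ⟫
          ≈⟨ ⟪⟫-cong F split ⟩
        ⟪ F , (λ f → ⟪ θ i P , (λ g → φ (f ⊕ g)) ⟫ +
                     - fromℕ ℓ * (exponent i f * ⟪ P , (λ g → φ (f ⊕ g)) ⟫)) ⟫
          ≈⟨ ⟪⟫-+ F _ _ ⟩
        ⟪ F , (λ f → ⟪ θ i P , (λ g → φ (f ⊕ g)) ⟫) ⟫ +
        ⟪ F , (λ f → - fromℕ ℓ * (exponent i f * ⟪ P , (λ g → φ (f ⊕ g)) ⟫)) ⟫
          ≈⟨ +-cong (sym (⟪⟫-* F (θ i P) φ)) (⟪⟫-scale F _ _) ⟩
        ⟪ F *ₚ θ i P , φ ⟫ + - fromℕ ℓ * ⟪ F , (λ f → exponent i f * ⟪ P , (λ g → φ (f ⊕ g)) ⟫) ⟫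
          ≈⟨ +-congˡ (*-congˡ (trans (sym (⟪⟫-θ i F _)) (sym (⟪⟫-* (θ i F) P φ)))) ⟩
        ⟪ F *ₚ θ i P , φ ⟫ + - fromℕ ℓ * ⟪ θ i F *ₚ P , φ ⟫
          ≈⟨ +-congˡ (-‿distribˡ-* _ _) ⟨
        ⟪ F *ₚ θ i P , φ ⟫ - fromℕ ℓ * ⟪ θ i F *ₚ P , φ ⟫ ∎
        where
        split : ∀ f → ⟪ P , (λ g → (exponent i g - exponent i f * fromℕ ℓ) * φ (f ⊕ g)) ⟫ ≈
                      ⟪ θ i P , (λ g → φ (f ⊕ g)) ⟫ +
                      - fromℕ ℓ * (exponent i f * ⟪ P , (λ g → φ (f ⊕ g)) ⟫)
        split f = begin
          ⟪ P , (λ g → (exponent i g - exponent i f * fromℕ ℓ) * φ (f ⊕ g)) ⟫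
            ≈⟨ (⟪⟫-cong P λ g → distribʳ _ _ _) ⟩
          ⟪ P , (λ g → exponent i g * φ (f ⊕ g) + - (exponent i f * fromℕ ℓ) * φ (f ⊕ g)) ⟫
            ≈⟨ ⟪⟫-+ P _ _ ⟩
          ⟪ P , (λ g → exponent i g * φ (f ⊕ g)) ⟫ +
          ⟪ P , (λ g → - (exponent i f * fromℕ ℓ) * φ (f ⊕ g)) ⟫
            ≈⟨ +-cong (sym (⟪⟫-θ i P _)) (⟪⟫-scale P _ _) ⟩
          ⟪ θ i P , (λ g → φ (f ⊕ g)) ⟫ + - (exponent i f * fromℕ ℓ) * ⟪ P , (λ g → φ (f ⊕ g)) ⟫
            ≈⟨ +-congˡ (*-congʳ (trans (-‿cong (*-comm _ _)) (-‿distribˡ-* _ _))) ⟩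
          ⟪ θ i P , (λ g → φ (f ⊕ g)) ⟫ + - fromℕ ℓ * exponent i f * ⟪ P , (λ g → φ (f ⊕ g)) ⟫
            ≈⟨ +-congˡ (*-assoc _ _ _) ⟩
          ⟪ θ i P , (λ g → φ (f ⊕ g)) ⟫ + - fromℕ ℓ * (exponent i f * ⟪ P , (λ g → φ (f ⊕ g)) ⟫) ∎

      -- The ℓ in the weight equals the exponent of `F`, so the term subtracted in `∑-entry` cancels
      -- the second term of `recurrence`. The surviving factor xᵢᵈ shifts the exponent from u - τ to
      -- u - τ - d eᵢ.
      row-recurrence : (a : ℕ) →
        let G = powerSum m d in
        ∑[ allB m h ] (λ (t , _) → Q-row t *
          coeff (G ^ₚ suc a *ₚ F ^ₚ ℓ) (Vec.zipWith ℤ._⊖_ u t)) ≈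
        fromℕ (suc a ℕ.* d) * coeff (G ^ₚ a *ₚ F ^ₚ suc ℓ) (Vec.zipWith ℤ._⊖_ u (τ ⊕ d ·eᵢ i))
      row-recurrence a = begin
        ∑[ allB m h ] _
          ≈⟨ ∑-entry P ⟩
        ⟪ F *ₚ θ i P , φ ⟫ - fromℕ ℓ * ⟪ θ i F *ₚ P , φ ⟫
          ≈⟨ +-congʳ (trans (pairing (recurrence i d a ℓ F) φ) (∑-++ (N ×ₚ (Xᵈ *ₚ P′)) _ _)) ⟩
        ⟪ N ×ₚ (Xᵈ *ₚ P′) , φ ⟫ + ⟪ ℓ ×ₚ (θ i F *ₚ P) , φ ⟫ - fromℕ ℓ * ⟪ θ i F *ₚ P , φ ⟫
          ≈⟨ +-congʳ (+-congˡ (⟪⟫-× ℓ (θ i F *ₚ P) φ)) ⟩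
        ⟪ N ×ₚ (Xᵈ *ₚ P′) , φ ⟫ + fromℕ ℓ * ⟪ θ i F *ₚ P , φ ⟫ - fromℕ ℓ * ⟪ θ i F *ₚ P , φ ⟫
          ≈⟨ trans (+-assoc _ _ _) (trans (+-congˡ (-‿inverseʳ _)) (+-identityʳ _)) ⟩
        ⟪ N ×ₚ (Xᵈ *ₚ P′) , φ ⟫
          ≈⟨ ⟪⟫-× N (Xᵈ *ₚ P′) φ ⟩
        fromℕ N * ⟪ Xᵈ *ₚ P′ , φ ⟫
          ≈⟨ *-congˡ (trans (⟪⟫-* Xᵈ P′ φ) (pairing (X-^ i d) _)) ⟩
        fromℕ N * ⟪ (1# , d ·eᵢ i) ∷ [] , (λ f → ⟪ P′ , (λ g → φ (f ⊕ g)) ⟫) ⟫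
          ≈⟨ *-congˡ (⟪⟫-monomial (d ·eᵢ i) λ f → ⟪ P′ , (λ g → φ (f ⊕ g)) ⟫) ⟩
        fromℕ N * ⟪ P′ , (λ g → δ u ((d ·eᵢ i ⊕ g) ⊕ τ)) ⟫
          ≈⟨ *-congˡ (⟪⟫-cong P′ λ g → reflexive (≡.cong (δ u) (rearrange g))) ⟩
        fromℕ N * ⟪ P′ , (λ g → δ u (g ⊕ (τ ⊕ d ·eᵢ i))) ⟫
          ≈⟨ *-congˡ (coeff-⊖ P′ u (τ ⊕ d ·eᵢ i)) ⟨
        fromℕ N * coeff P′ (Vec.zipWith ℤ._⊖_ u (τ ⊕ d ·eᵢ i)) ∎
        where
        G  = powerSum m d
        P  = G ^ₚ suc a *ₚ F ^ₚ ℓ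
        P′ = G ^ₚ a *ₚ F ^ₚ suc ℓ
        N  = suc a ℕ.* d
        Xᵈ = X i ^ₚ d
        rearrange : ∀ g → (d ·eᵢ i ⊕ g) ⊕ τ ≡ g ⊕ (τ ⊕ d ·eᵢ i)
        rearrange g =
          ≡.trans (⊕-assoc (d ·eᵢ i) g τ)
            (≡.trans (⊕-comm (d ·eᵢ i) (g ⊕ τ)) (⊕-assoc g τ (d ·eᵢ i)))

-- Iterated matrix products and the constant d^N N!.

module MatrixAction (R : CommutativeRing c e) (m h : ℕ) where
  open CommutativeRing R
  open Sums R
  open Indicators R
  open Matrices (Semiring.rawSemiring semiring) m h
  open CommutativeSemigroupProperties *-commutativeSemigroup using (x∙yz≈y∙xz)
  open SetoidReasoning setoid

  identity-∙ⱽ : (x : Vector) → identity ∙ⱽ x ≈ⱽ x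
  identity-∙ⱽ x t = begin
    ∑[ allB m h ] (λ t′ → identity t t′ * x t′)
      ≈⟨ ∑-single (allB-unique m h) (allB-complete t)
           (λ t′ t≢t′ → trans (*-congʳ (⟦⟧-false (proj₁ t ≟ⱽ proj₁ t′) (t≢t′ ∘ B-≡))) (zeroˡ _)) ⟩
    identity t t * x t
      ≈⟨ *-congʳ (⟦⟧-true (proj₁ t ≟ⱽ proj₁ t) ≡.refl) ⟩
    1# * x t
      ≈⟨ *-identityˡ _ ⟩
    x t ∎

  ⊗-∙ⱽ : (M N : Matrix) (x : Vector) → (M ⊗ N) ∙ⱽ x ≈ⱽ M ∙ⱽ (N ∙ⱽ x)
  ⊗-∙ⱽ M N x t = begin
    ∑[ ts ] (λ t″ → ∑[ ts ] (λ t′ → M t t′ * N t′ t″) * x t″)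
      ≈⟨ ∑-cong ts (λ t″ → ∑-distribʳ ts _ _) ⟩
    ∑[ ts ] (λ t″ → ∑[ ts ] λ t′ → M t t′ * N t′ t″ * x t″)
      ≈⟨ ∑-swap ts ts _ ⟩
    ∑[ ts ] (λ t′ → ∑[ ts ] λ t″ → M t t′ * N t′ t″ * x t″)
      ≈⟨ ∑-cong ts (λ t′ → trans (∑-cong ts λ t″ → *-assoc _ _ _) (sym (∑-distribˡ ts _ _))) ⟩
    ∑[ ts ] (λ t′ → M t t′ * ∑[ ts ] (λ t″ → N t′ t″ * x t″)) ∎
    where ts = allB m h

  ∙ⱽ-· : (M : Matrix) (r : Carrier) (x : Vector) → M ∙ⱽ (r · x) ≈ⱽ r · (M ∙ⱽ x)
  ∙ⱽ-· M r x t =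
    trans (∑-cong (allB m h) λ t′ → x∙yz≈y∙xz _ _ _) (sym (∑-distribˡ (allB m h) _ _))

  ∏ : (ℕ → Carrier) → ℕ → Carrier
  ∏ r zero    = 1#
  ∏ r (suc N) = r N * ∏ r N

  -- Scalars commute with matrices, so the factors `r j` can be collected in front instead of being
  -- divided out at each step.
  descendingProduct-∙ⱽ : (M : ℕ → Matrix) (r : ℕ → Carrier) (x : ℕ → Vector) (N : ℕ) →
    (∀ j → j ℕ.< N → r j · x (suc j) ≈ⱽ M j ∙ⱽ x j) →
    descendingProduct M N ∙ⱽ x 0 ≈ⱽ ∏ r N · x N
  descendingProduct-∙ⱽ M r x zero    step t = trans (identity-∙ⱽ (x 0) t) (sym (*-identityˡ _))
  descendingProduct-∙ⱽ M r x (suc N) step t = begin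
    ((M N ⊗ descendingProduct M N) ∙ⱽ x 0) t   ≈⟨ ⊗-∙ⱽ (M N) (descendingProduct M N) (x 0) t ⟩
    (M N ∙ⱽ (descendingProduct M N ∙ⱽ x 0)) t
      ≈⟨ (∑-cong (allB m h) λ t′ → *-congˡ
           (descendingProduct-∙ⱽ M r x N (λ j j<N → step j (ℕ.m<n⇒m<1+n j<N)) t′)) ⟩
    (M N ∙ⱽ (∏ r N · x N)) t                   ≈⟨ ∙ⱽ-· (M N) (∏ r N) (x N) t ⟩
    ∏ r N * (M N ∙ⱽ x N) t                     ≈⟨ *-congˡ (step N ℕ.≤-refl t) ⟨
    ∏ r N * (r N * x (suc N) t)                ≈⟨ x∙yz≈y∙xz _ _ _ ⟩
    r N * (∏ r N * x (suc N) t)                ≈⟨ *-assoc _ _ _ ⟨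
    ∏ r (suc N) * x (suc N) t                  ∎

module DescendingFactorial (R : CommutativeRing c e) (m h : ℕ) where
  open CommutativeRing R
  open Polynomials R
  open MatrixAction R m h using (∏)
  open SemiringMult semiring using (×1-homo-*; ×-homo-1)
  open SetoidReasoning setoid

  -- The partial product is d^J N! / (N - J)!. Multiplying by the leftover factorial lets the
  -- induction run in R without division.
  ∏-descending : (d N J : ℕ) → J ℕ.≤ N →
    ∏ (λ j → fromℕ (d ℕ.* (N ℕ.∸ j))) J * fromℕ ((N ℕ.∸ J) ℕ.!) ≈ fromℕ (d ℕ.^ J ℕ.* N ℕ.!)
  ∏-descending d N zero    _   =
    trans (*-identityˡ _) (reflexive (≡.cong fromℕ (≡.sym (ℕ.*-identityˡ (N ℕ.!)))))
  ∏-descending d N (suc J) J<N = begin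
    fromℕ (d ℕ.* (N ℕ.∸ J)) * Π * fromℕ ((N ℕ.∸ suc J) ℕ.!)
      ≈⟨ *-congʳ (*-congʳ (×1-homo-* d _)) ⟩
    fromℕ d * fromℕ (N ℕ.∸ J) * Π * fromℕ ((N ℕ.∸ suc J) ℕ.!)
      ≈⟨ solve 4 (λ a b p q → a :* b :* p :* q := a :* (p :* (b :* q))) refl _ _ _ _ ⟩
    fromℕ d * (Π * (fromℕ (N ℕ.∸ J) * fromℕ ((N ℕ.∸ suc J) ℕ.!)))
      ≈⟨ *-congˡ (*-congˡ (×1-homo-* (N ℕ.∸ J) _)) ⟨
    fromℕ d * (Π * fromℕ ((N ℕ.∸ J) ℕ.* (N ℕ.∸ suc J) ℕ.!))
      ≡⟨ ≡.cong (λ x → fromℕ d * (Π * fromℕ x)) factorial ⟩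
    fromℕ d * (Π * fromℕ ((N ℕ.∸ J) ℕ.!))
      ≈⟨ *-congˡ (∏-descending d N J (ℕ.<⇒≤ J<N)) ⟩
    fromℕ d * fromℕ (d ℕ.^ J ℕ.* N ℕ.!)
      ≈⟨ ×1-homo-* d _ ⟨
    fromℕ (d ℕ.* (d ℕ.^ J ℕ.* N ℕ.!))
      ≡⟨ ≡.cong fromℕ (ℕ.*-assoc d (d ℕ.^ J) (N ℕ.!)) ⟨
    fromℕ (d ℕ.^ suc J ℕ.* N ℕ.!) ∎
    where
    open SemiringSolver commutativeSemiring using (solve; _:*_; _:=_)
    Π = ∏ (λ j → fromℕ (d ℕ.* (N ℕ.∸ j))) J
    factorial : (N ℕ.∸ J) ℕ.* (N ℕ.∸ suc J) ℕ.! ≡ (N ℕ.∸ J) ℕ.!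
    -- Since J < N, the number N ∸ J is a successor, and the claim becomes the defining equation of
    -- the factorial.
    factorial rewrite ≡.sym (ℕ.suc-pred (N ℕ.∸ J) {{ℕ.>-nonZero (ℕ.m<n⇒0<n∸m J<N)}})
                    | ℕ.pred[m∸n]≡m∸[1+n] N J = ≡.refl

  ∏-factorial : (d N : ℕ) →
    ∏ (λ j → fromℕ (d ℕ.* (N ℕ.∸ j))) N ≈ fromℕ (d ℕ.^ N ℕ.* N ℕ.!)
  ∏-factorial d N = begin
    Π                                  ≈⟨ *-identityʳ _ ⟨
    Π * 1#                             ≈⟨ *-congˡ (×-homo-1 1#) ⟨
    Π * fromℕ (0 ℕ.!)                  ≡⟨ ≡.cong (λ x → Π * fromℕ (x ℕ.!)) (ℕ.n∸n≡0 N) ⟨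
    Π * fromℕ ((N ℕ.∸ N) ℕ.!)          ≈⟨ ∏-descending d N N ℕ.≤-refl ⟩
    fromℕ (d ℕ.^ N ℕ.* N ℕ.!)          ∎
    where Π = ∏ (λ j → fromℕ (d ℕ.* (N ℕ.∸ j))) N

-- Fractions that represent elements of R.

module IntegralFractions (R : CommutativeRing c e) (dom : IsIntegralDomain R) where
  open CommutativeRing R
  open Polynomials R
  open FractionField R dom
  open Fraction
  open SemiringSolver commutativeSemiring using (solve; _:*_; _:+_; _:=_)
  private module K = RawSemiring fractionSemiring

  -- Denominators differ along a computation, so a fraction equal to ι a is
  -- tracked through num ≈ a * den; sums and products then need no cancellation.
  record _represents_ (p : Fraction) (a : Carrier) : Set e where
    constructor mkRepresents
    field num≈ : num p ≈ a * den p
  open _represents_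

  ι-represents : ∀ a → ι a represents a
  ι-represents a .num≈ = sym (*-identityʳ a)

  +-represents : ∀ {p q a b} → p represents a → q represents b → (p K.+ q) represents (a + b)
  +-represents {p} {q} {a} {b} p≈a q≈b .num≈ =
    trans (+-cong (*-congʳ (num≈ p≈a)) (*-congʳ (num≈ q≈b)))
      (solve 4 (λ a b x y → a :* x :* y :+ b :* y :* x := (a :+ b) :* (x :* y))
        refl a b (den p) (den q))

  *-represents : ∀ {p q a b} → p represents a → q represents b → (p K.* q) represents (a * b)
  *-represents {p} {q} {a} {b} p≈a q≈b .num≈ =
    trans (*-cong (num≈ p≈a) (num≈ q≈b))
      (solve 4 (λ a b x y → a :* x :* (b :* y) := a :* b :* (x :* y))
        refl a b (den p) (den q))

  -- Equality of fractions is cross-multiplied, so dividing by k only asks for the equation y = k x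
  -- in R.
  reciprocal-* : (char0 : CharacteristicZero R) (k : ℕ) .{{_ : ℕ.NonZero k}} →
                 ∀ {x y q} → q represents y → y ≈ fromℕ k * x →
                 ι x K.≈ (reciprocal char0 k K.* q)
  reciprocal-* char0 k {x} {y} {q} q≈y y≈kx = begin
    x * (fromℕ k * den q)
      ≈⟨ solve 3 (λ x k d → x :* (k :* d) := k :* x :* d) refl x (fromℕ k) (den q) ⟩
    fromℕ k * x * den q     ≈⟨ *-congʳ y≈kx ⟨
    y * den q               ≈⟨ num≈ q≈y ⟨
    num q                   ≈⟨ *-identityˡ _ ⟨
    1# * num q              ≈⟨ *-identityʳ _ ⟨
    1# * num q * 1#         ∎
    where open SetoidReasoning setoid

  module _ (m h : ℕ) where
    private
      module MatR = Matrices (Semiring.rawSemiring semiring) m h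
      module MatK = Matrices fractionSemiring m h

    ∑-represents : ∀ {f g} → (∀ t → f t represents g t) → MatK.∑ f represents MatR.∑ g
    ∑-represents {f} {g} f≈g = go (allB m h)
      where
      go : ∀ ts → List.foldr K._+_ K.0# (List.map f ts) represents List.foldr _+_ 0# (List.map g ts)
      go []       = ι-represents 0#
      go (t ∷ ts) = +-represents (f≈g t) (go ts)

    identity-represents : ∀ t t′ → MatK.identity t t′ represents MatR.identity t t′
    identity-represents t t′ with does (Vec.≡-dec ℕ._≟_ (proj₁ t) (proj₁ t′))
    ... | true  = ι-represents 1#
    ... | false = ι-represents 0#

    descendingProduct-represents : ∀ {M M′} → (∀ j t t′ → M j t t′ represents M′ j t t′) →
      ∀ N t t′ → MatK.descendingProduct M N t t′ represents MatR.descendingProduct M′ N t t′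
    descendingProduct-represents M≈ zero    t t′ = identity-represents t t′
    descendingProduct-represents M≈ (suc N) t t′ =
      ∑-represents λ t″ → *-represents (M≈ N t t″) (descendingProduct-represents M≈ N t″ t′)

-- Assembling `Q` and iterating the recurrence.

module Recurrence (R : CommutativeRing c e) {m : ℕ} (d : ℕ)
                  (F : Polynomials.Poly R m) (homF : Polynomials.Homogeneous R d F)
                  {h r : ℕ} (m[d-1]<h : m ℕ.* (d ℕ.∸ 1) ℕ.< h) (v : B m r) (w : B m h) where
  open CommutativeRing R
  open Polynomials R
  open PolynomialAlgebra R
  open Coefficients R
  open Matrices (Semiring.rawSemiring semiring) m h
  open MatrixAction R m h
  open DescendingFactorial R m h
  open SetoidReasoning setoid

  private
    module P = CommutativeSemiring (polynomials m)
    G = powerSum m d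

  -- Each row may use its own variable xᵢ, since the rows of the recurrence are separate equations.
  -- The choice depends on `t` alone, hence not on k or ℓ.
  split : (t : B m h) → ∃ λ i → ∃ λ τ → proj₁ t ≡ τ ⊕ d ·eᵢ i
  split (t , ≡.refl) = pigeonhole d t m[d-1]<h

  module Rowₜ (t : B m h) =
    Row R d F homF (proj₁ v) (proj₁ w) (proj₁ (split t)) (proj₁ (proj₂ (split t)))

  Q : B m h → B m h → Poly 2
  Q t (t′ , _) = Rowₜ.entry t t′

  Q-totalDegree : ∀ t t′ → TotalDegree≤ 1 (Q t t′)
  Q-totalDegree t (t′ , _) = Rowₜ.entry-totalDegree t t′

  coeffVector-cong : ∀ k {p q} → p ≋ q → coeffVector v w k p ≈ⱽ coeffVector v w k q
  coeffVector-cong k {p} {q} p≋q (t , _) =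
    trans (coeff-⊖ p _ t) (trans (pairing p≋q _) (sym (coeff-⊖ q _ t)))

  Q-suc : ∀ k ℓ a → fromℕ (d ℕ.* suc a) · coeffVector v w k (G ^ₚ a *ₚ F ^ₚ suc ℓ) ≈ⱽ
                    evalMatrix Q k ℓ ∙ⱽ coeffVector v w k (G ^ₚ suc a *ₚ F ^ₚ ℓ)
  Q-suc k ℓ a t@(t₀ , ∑t₀≡h) = begin
    fromℕ (d ℕ.* suc a) * coeff P′ (Vec.zipWith ℤ._⊖_ u t₀)
      ≡⟨ ≡.cong₂ (λ x y → fromℕ x * coeff P′ (Vec.zipWith ℤ._⊖_ u y)) (ℕ.*-comm d (suc a)) t₀≡ ⟩
    fromℕ (suc a ℕ.* d) * coeff P′ (Vec.zipWith ℤ._⊖_ u (τ ⊕ d ·eᵢ i))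
      ≈⟨ Rowₜ.row-recurrence t k ℓ h d+∑τ≡h a ⟨
    (evalMatrix Q k ℓ ∙ⱽ coeffVector v w k (G ^ₚ suc a *ₚ F ^ₚ ℓ)) t ∎
    where
    P′  = G ^ₚ a *ₚ F ^ₚ suc ℓ
    u   = Vec.map (k ℕ.*_) (proj₁ v) ⊕ proj₁ w
    i   = proj₁ (split t)
    τ   = proj₁ (proj₂ (split t))
    t₀≡ = proj₂ (proj₂ (split t))
    d+∑τ≡h : d ℕ.+ Vec.sum τ ≡ h
    d+∑τ≡h =
      ≡.trans (ℕ.+-comm d (Vec.sum τ))
        (≡.trans (≡.cong (Vec.sum τ ℕ.+_) (≡.sym (sum-·eᵢ d i)))
          (≡.trans (≡.sym (sum-⊕ τ (d ·eᵢ i)))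
            (≡.trans (≡.cong Vec.sum (≡.sym t₀≡)) ∑t₀≡h)))

  Q-step : ∀ k ℓ N → ℓ ℕ.< N →
    fromℕ (d ℕ.* (N ℕ.∸ ℓ)) · coeffVector v w k (G ^ₚ (N ℕ.∸ ℓ ℕ.∸ 1) *ₚ F ^ₚ suc ℓ) ≈ⱽ
    evalMatrix Q k ℓ ∙ⱽ coeffVector v w k (G ^ₚ (N ℕ.∸ ℓ) *ₚ F ^ₚ ℓ)
  -- The positivity of N ∸ ℓ excludes zero, so the truncated exponent N ∸ ℓ ∸ 1 is a true
  -- predecessor.
  Q-step k ℓ N ℓ<N with N ℕ.∸ ℓ | ℕ.m<n⇒0<n∸m ℓ<N
  ... | suc a | _ = Q-suc k ℓ a

  -- The products G^(N-j) F^j lead from G^N to F^N, and each factor of the matrix product advances j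
  -- by one.
  Q-product : ∀ k N → descendingProduct (evalMatrix Q k) N ∙ⱽ coeffVector v w k (G ^ₚ N) ≈ⱽ
                      fromℕ (d ℕ.^ N ℕ.* N ℕ.!) · coeffVector v w k (F ^ₚ N)
  Q-product k N t = begin
    (descendingProduct (evalMatrix Q k) N ∙ⱽ coeffVector v w k (G ^ₚ N)) t
      ≈⟨ (∑-cong (allB m h) λ t′ → *-congˡ (coeffVector-cong k (P.*-identityʳ (G ^ₚ N)) t′)) ⟨
    (descendingProduct (evalMatrix Q k) N ∙ⱽ x 0) t
      ≈⟨ descendingProduct-∙ⱽ (evalMatrix Q k) _ x N step t ⟩
    ∏ (λ j → fromℕ (d ℕ.* (N ℕ.∸ j))) N * x N t
      ≈⟨ *-cong (∏-factorial d N) (coeffVector-cong k xN t) ⟩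
    fromℕ (d ℕ.^ N ℕ.* N ℕ.!) * coeffVector v w k (F ^ₚ N) t ∎
    where
    open Sums R
    x : ℕ → Vector
    x j = coeffVector v w k (G ^ₚ (N ℕ.∸ j) *ₚ F ^ₚ j)
    xN : G ^ₚ (N ℕ.∸ N) *ₚ F ^ₚ N ≋ F ^ₚ N
    xN = P.trans (P.reflexive (≡.cong (λ j → G ^ₚ j *ₚ F ^ₚ N) (ℕ.n∸n≡0 N)))
                 (P.*-identityˡ (F ^ₚ N))
    step : ∀ j → j ℕ.< N → fromℕ (d ℕ.* (N ℕ.∸ j)) · x (suc j) ≈ⱽ evalMatrix Q k j ∙ⱽ x j
    -- `x (suc j)` carries the exponent N ∸ suc j, whereas `Q-step` speaks of N ∸ j ∸ 1.
    step j j<N t = trans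
      (reflexive (≡.cong
        (λ l → fromℕ (d ℕ.* (N ℕ.∸ j)) * coeffVector v w k (G ^ₚ l *ₚ F ^ₚ suc j) t)
        (≡.sym (≡.trans (ℕ.∸-+-assoc N j 1) (≡.cong (N ℕ.∸_) (ℕ.+-comm j 1))))))
      (Q-step k j N j<N t)

open import Data.Nat.Base using (ℕ; suc; _+_; _*_; _∸_; _^_; _!; _≤_; _<_)

theorem4p1 : ∀ {c e} (R : CommutativeRing c e)
  (dom : IsIntegralDomain R) (char0 : CharacteristicZero R) →
  let open Polynomials R
      open FractionField R dom
  in
  (n d : ℕ) → 1 ≤ n → (1≤d : 1 ≤ d) →
  (F : Poly (suc n)) → Homogeneous d F →
  (s h : ℕ) → 1 ≤ s → (d ∸ 1) * (n + 1) + 1 ≤ h →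
  (v : B (suc n) (d * s)) (w : B (suc n) h) →
  let G = powerSum (suc n) d
      [_]at_ = λ (H : Poly (suc n)) (k : ℕ) → coeffVector v w k H
      module MatR = Matrices (Semiring.rawSemiring (CommutativeRing.semiring R)) (suc n) h
      module MatK = Matrices fractionSemiring (suc n) h
  in
  ∃ λ (Q : B (suc n) h → B (suc n) h → Poly 2) →
    (∀ t t′ → TotalDegree≤ 1 (Q t t′)) ×
    (∀ k₀ ℓ₀ → 1 ≤ k₀ → ℓ₀ < k₀ * s →
      fromℕ (d * (k₀ * s ∸ ℓ₀)) MatR.· [ G ^ₚ (k₀ * s ∸ ℓ₀ ∸ 1) *ₚ F ^ₚ (ℓ₀ + 1) ]at k₀
        MatR.≈ⱽ
      evalMatrix Q k₀ ℓ₀ MatR.∙ⱽ [ G ^ₚ (k₀ * s ∸ ℓ₀) *ₚ F ^ₚ ℓ₀ ]at k₀) ×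
    (∀ k₀ → 1 ≤ k₀ →
      (λ t → ι (([ F ^ₚ (k₀ * s) ]at k₀) t))
        MatK.≈ⱽ
      reciprocal char0 (d ^ (k₀ * s) * (k₀ * s) !) {{d^N*N!≢0 1≤d (k₀ * s)}}
        MatK.· MatK.descendingProduct (λ ℓ₀ t t′ → ι (evalMatrix Q k₀ ℓ₀ t t′)) (k₀ * s)
        MatK.∙ⱽ (λ t → ι (([ G ^ₚ (k₀ * s) ]at k₀) t)))
theorem4p1 R dom char0 n d _ 1≤d F homF s h _ bound v w =
  Q , Q-totalDegree ,
  (λ k ℓ _ ℓ<ks t →
    trans (reflexive (≡.cong (lhs k ℓ t) (ℕ.+-comm ℓ 1))) (Q-step k ℓ (k * s) ℓ<ks t)) ,
  λ k _ t →
    -- Each entry computed in the fraction field represents its counterpart in R, so `Q-product`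
    -- supplies the equation with cleared denominator.
    reciprocal-* char0 (d ^ (k * s) * (k * s) !) {{d^N*N!≢0 1≤d (k * s)}}
      (∑-represents (suc n) h λ t′ → *-represents
        (descendingProduct-represents (suc n) h (λ ℓ t t′ → ι-represents _) (k * s) t t′)
        (ι-represents _))
      (Q-product k (k * s) t)
  where
  module R = CommutativeRing R
  open R using (trans; reflexive)
  open Polynomials R
  open FractionField R dom
  open IntegralFractions R dom
  m[d-1]<h : suc n * (d ∸ 1) < h
  m[d-1]<h = begin
    suc (suc n * (d ∸ 1))    ≡⟨ ≡.cong (λ m → suc (m * (d ∸ 1))) (ℕ.+-comm 1 n) ⟩
    suc ((n + 1) * (d ∸ 1))  ≡⟨ ≡.cong suc (ℕ.*-comm (n + 1) (d ∸ 1)) ⟩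
    suc ((d ∸ 1) * (n + 1))  ≡⟨ ℕ.+-comm 1 ((d ∸ 1) * (n + 1)) ⟩
    (d ∸ 1) * (n + 1) + 1    ≤⟨ bound ⟩
    h                        ∎
    where open ℕ.≤-Reasoning
  open Recurrence R d F homF m[d-1]<h v w
  lhs : ℕ → ℕ → B (suc n) h → ℕ → R.Carrier
  lhs k ℓ t j = fromℕ (d * (k * s ∸ ℓ)) R.*
    coeffVector v w k (powerSum (suc n) d ^ₚ (k * s ∸ ℓ ∸ 1) *ₚ F ^ₚ j) t
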